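{- Let $n\ge 2$ be an integer, let $0<\gamma_1,\gamma_2<1$, let $c_6>0$ be a fixed constant, and let $\mathbf{d}=(d_1,d_2)\in\mathbb{R}^2$ with $d_1\ne d_2$. For $Q>1$ let $\Pi=I_1\times I_2\subset\mathbb{R}^2$ be the rectangle with midpoint $\mathbf{d}$ whose sides are intervals of lengths $\mu_1 I_i=c_6Q^{ -\gamma_i}$, $i=1,2$. Then there is $Q_0=Q_0(n,\gamma_1,\gamma_2,\mathbf{d})$ such that for all $Q>Q_0$ $$\#\left(\tilde{\mathbb{A}}_n^2(Q)\cap\Pi\right)<c_7\,Q^{n}\mu_2\Pi,$$ where $$c_7=2^{3n+8}n^2\rho_n(d_1)\rho_n(d_2)\,|d_1-d_2|^{ -1},\qquad \rho_n(x)=\frac{(|x|+1)^{n+1}-1}{|x|}$$ (with $\rho_n(0)=n+1$).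
   Context: The height $H(P)$ of a polynomial $P\in\mathbb{Z}[t]$ is the maximum of the absolute values of its coefficients. An algebraic integer point is a point $\boldsymbol{\alpha}=(\alpha_1,\alpha_2)$ whose coordinates are roots of the same monic polynomial $P\in\mathbb{Z}[t]$ that is irreducible over $\mathbb{Q}$; $P$ is the minimal polynomial of $\boldsymbol{\alpha}$, and $\deg\boldsymbol{\alpha}:=\deg P$, $H(\boldsymbol{\alpha}):=H(P)$. $\tilde{\mathbb{A}}_n^2(Q)$ denotes the set of algebraic integer points $\boldsymbol{\alpha}$ with $\deg\boldsymbol{\alpha}=n$ and $H(\boldsymbol{\alpha})\le Q$. $\mu_k$ is Lebesgue measure on $\mathbb{R}^k$ and $\#S$ is the cardinality of a finite set $S$. The constant $c_6$ is independent of $Q$ and fixed in advance; $Q_0$ may also depend on it. -}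

module Defs where

open import Algebra.Bundles.Raw using (RawSemiring)
open import Data.Integer.Base as ℤ using (ℤ)
open import Data.List.Base using (List; []; _∷_; map; foldr; length)
open import Data.List.Relation.Unary.All using (All)
import Data.List.Relation.Unary.Unique.Setoid as UniqueSetoid
open import Data.Nat.Base as ℕ using (ℕ; zero; suc)
import Data.Nat.Properties as ℕ
open import Data.Product.Base using (_×_; _,_; proj₁; proj₂; ∃-syntax)
open import Data.Product.Relation.Binary.Pointwise.NonDependent using (×-setoid)
open import Data.Rational.Base as ℚ using (ℚ; 0ℚ; 1ℚ; ½)
import Data.Rational.Properties as ℚ
import Data.Rational.Solver as ℚSolver
open import Data.Sum.Base using (_⊎_; inj₁; inj₂)
open import Level using (0ℓ)
open import Relation.Binary.Bundles using (Setoid)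
open import Relation.Binary.PropositionalEquality
open import Relation.Nullary using (¬_; yes; no; contradiction)
open import Relation.Unary using (Pred)

private module R = ℚSolver.+-*-Solver

∣p-r∣≤∣p-q∣+∣q-r∣ : ∀ p q r → ℚ.∣ p ℚ.- r ∣ ℚ.≤ ℚ.∣ p ℚ.- q ∣ ℚ.+ ℚ.∣ q ℚ.- r ∣
∣p-r∣≤∣p-q∣+∣q-r∣ p q r = subst (λ z → ℚ.∣ z ∣ ℚ.≤ ℚ.∣ p ℚ.- q ∣ ℚ.+ ℚ.∣ q ℚ.- r ∣)
  (R.solve 3 (λ p q r → (p R.:- q) R.:+ (q R.:- r) R.:= p R.:- r) refl p q r)
  (ℚ.∣p+q∣≤∣p∣+∣q∣ (p ℚ.- q) (q ℚ.- r))

∣-∣-swap : ∀ p q → ℚ.∣ p ℚ.- q ∣ ≡ ℚ.∣ q ℚ.- p ∣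
∣-∣-swap p q = trans (sym (ℚ.∣-p∣≡∣p∣ (p ℚ.- q)))
  (cong ℚ.∣_∣ (R.solve 2 (λ p q → R.:- (p R.:- q) R.:= q R.:- p) refl p q))

half>0 : ∀ {ε} → 0ℚ ℚ.< ε → 0ℚ ℚ.< ½ ℚ.* ε
half>0 {ε} ε>0 = subst (ℚ._< ½ ℚ.* ε) (ℚ.*-zeroʳ ½) (ℚ.*-monoʳ-<-pos ½ ε>0)

halves : ∀ ε → ½ ℚ.* ε ℚ.+ ½ ℚ.* ε ≡ ε
halves ε = trans (sym (ℚ.*-distribʳ-+ ε ½ ½)) (ℚ.*-identityˡ ε)

*>0 : ∀ {p q} → 0ℚ ℚ.< p → 0ℚ ℚ.< q → 0ℚ ℚ.< p ℚ.* q
*>0 {p} {q} p>0 q>0 = subst (ℚ._< p ℚ.* q) (ℚ.*-zeroʳ p)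
  (ℚ.*-monoʳ-<-pos p {{ℚ.positive p>0}} q>0)

*-mono-≤-nonNeg : ∀ {p q r s} → 0ℚ ℚ.≤ r → 0ℚ ℚ.≤ q →
                  p ℚ.≤ q → r ℚ.≤ s → p ℚ.* r ℚ.≤ q ℚ.* s
*-mono-≤-nonNeg {q = q} {r = r} r≥0 q≥0 p≤q r≤s = ℚ.≤-trans
  (ℚ.*-monoʳ-≤-nonNeg r {{ℚ.nonNegative r≥0}} p≤q)
  (ℚ.*-monoˡ-≤-nonNeg q {{ℚ.nonNegative q≥0}} r≤s)

Cauchy : (ℕ → ℚ) → Set
Cauchy s = ∀ ε → 0ℚ ℚ.< ε →
  ∃[ N ] (∀ m n → N ℕ.≤ m → N ℕ.≤ n → ℚ.∣ s m ℚ.- s n ∣ ℚ.< ε)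

record ℝ : Set where
  no-eta-equality
  constructor mkℝ
  field
    seq    : ℕ → ℚ
    cauchy : Cauchy seq

open ℝ public

infix 4 _≈_ _<_ _≤_ _#_

_≈_ : ℝ → ℝ → Set
x ≈ y = ∀ ε → 0ℚ ℚ.< ε →
  ∃[ N ] (∀ n → N ℕ.≤ n → ℚ.∣ seq x n ℚ.- seq y n ∣ ℚ.< ε)

_<_ : ℝ → ℝ → Set
x < y = ∃[ ε ] (0ℚ ℚ.< ε ×
  ∃[ N ] (∀ n → N ℕ.≤ n → seq x n ℚ.+ ε ℚ.≤ seq y n))

_≤_ : ℝ → ℝ → Set
x ≤ y = ¬ (y < x)

-- Constructively, two reals are distinct when they can be told apart;
-- classically x # y is equivalent to ¬ (x ≈ y).
_#_ : ℝ → ℝ → Set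
x # y = x < y ⊎ y < x

ℝ-setoid : Setoid 0ℓ 0ℓ
ℝ-setoid = record
  { Carrier = ℝ
  ; _≈_ = _≈_
  ; isEquivalence = record
    { refl  = λ {x} ε ε>0 → 0 , λ n _ →
        subst (ℚ._< ε) (sym (cong ℚ.∣_∣ (ℚ.+-inverseʳ (seq x n)))) ε>0
    ; sym   = λ {x} {y} x≈y ε ε>0 → let N , h = x≈y ε ε>0 in
        N , λ n N≤n → subst (ℚ._< ε) (∣-∣-swap (seq x n) (seq y n)) (h n N≤n)
    ; trans = λ {x} {y} {z} x≈y y≈z ε ε>0 →
        let N , h = x≈y (½ ℚ.* ε) (half>0 ε>0)
            M , k = y≈z (½ ℚ.* ε) (half>0 ε>0)
        in N ℕ.⊔ M , λ n le → ℚ.≤-<-trans (∣p-r∣≤∣p-q∣+∣q-r∣ (seq x n) (seq y n) (seq z n))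
             (subst (_ ℚ.<_) (halves ε)
               (ℚ.+-mono-< (h n (ℕ.m⊔n≤o⇒m≤o N M le)) (k n (ℕ.m⊔n≤o⇒n≤o N M le))))
    }
  }

abstract
  const-cauchy : ∀ q → Cauchy (λ _ → q)
  const-cauchy q ε ε>0 = 0 , λ _ _ _ _ →
    subst (ℚ._< ε) (sym (cong ℚ.∣_∣ (ℚ.+-inverseʳ q))) ε>0

fromℚ : ℚ → ℝ
fromℚ q = mkℝ (λ _ → q) (const-cauchy q)

fromℤ : ℤ → ℝ
fromℤ z = fromℚ (z ℚ./ 1)

fromℕ : ℕ → ℝ
fromℕ k = fromℤ (ℤ.+ k)

0ℝ 1ℝ : ℝ
0ℝ = fromℚ 0ℚ
1ℝ = fromℚ 1ℚ

infix  8 -_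
infixl 7 _*_
infixl 6 _+_ _-_
infixr 8 _^_

abstract
  +-cauchy : ∀ x y → Cauchy (λ n → seq x n ℚ.+ seq y n)
  +-cauchy x y ε ε>0 =
    let N , h = cauchy x (½ ℚ.* ε) (half>0 ε>0)
        M , k = cauchy y (½ ℚ.* ε) (half>0 ε>0)
    in N ℕ.⊔ M , λ m n m≥ n≥ → ℚ.≤-<-trans
         (subst (ℚ._≤ ℚ.∣ seq x m ℚ.- seq x n ∣ ℚ.+ ℚ.∣ seq y m ℚ.- seq y n ∣)
           (cong ℚ.∣_∣ (R.solve 4 (λ a b c d → (a R.:- b) R.:+ (c R.:- d) R.:= (a R.:+ c) R.:- (b R.:+ d))
             refl (seq x m) (seq x n) (seq y m) (seq y n)))
           (ℚ.∣p+q∣≤∣p∣+∣q∣ (seq x m ℚ.- seq x n) (seq y m ℚ.- seq y n)))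
         (subst (_ ℚ.<_) (halves ε) (ℚ.+-mono-<
           (h m n (ℕ.m⊔n≤o⇒m≤o N M m≥) (ℕ.m⊔n≤o⇒m≤o N M n≥))
           (k m n (ℕ.m⊔n≤o⇒n≤o N M m≥) (ℕ.m⊔n≤o⇒n≤o N M n≥))))

_+_ : ℝ → ℝ → ℝ
x + y = mkℝ (λ n → seq x n ℚ.+ seq y n) (+-cauchy x y)

abstract
  neg-cauchy : ∀ x → Cauchy (λ n → ℚ.- seq x n)
  neg-cauchy x ε ε>0 =
    let N , h = cauchy x ε ε>0
    in N , λ m n m≥ n≥ → subst (ℚ._< ε)
         (trans (∣-∣-swap (seq x m) (seq x n)) (cong ℚ.∣_∣
           (R.solve 2 (λ a b → b R.:- a R.:= (R.:- a) R.:- (R.:- b)) refl (seq x m) (seq x n))))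
         (h m n m≥ n≥)

-_ : ℝ → ℝ
- x = mkℝ (λ n → ℚ.- seq x n) (neg-cauchy x)

_-_ : ℝ → ℝ → ℝ
x - y = x + - y

eventually-bounded : ∀ x → ∃[ B ] (0ℚ ℚ.< B ×
  ∃[ N ] (∀ n → N ℕ.≤ n → ℚ.∣ seq x n ∣ ℚ.≤ B))
eventually-bounded x with cauchy x 1ℚ (ℚ.positive⁻¹ 1ℚ)
... | N , h = 1ℚ ℚ.+ ℚ.∣ seq x N ∣
    , ℚ.+-mono-<-≤ (ℚ.positive⁻¹ 1ℚ) (ℚ.0≤∣p∣ (seq x N))
    , N , λ n n≥ → ℚ.≤-trans
        (subst (ℚ._≤ ℚ.∣ seq x n ℚ.- seq x N ∣ ℚ.+ ℚ.∣ seq x N ∣)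
          (cong ℚ.∣_∣ (R.solve 2 (λ a b → (a R.:- b) R.:+ b R.:= a) refl (seq x n) (seq x N)))
          (ℚ.∣p+q∣≤∣p∣+∣q∣ (seq x n ℚ.- seq x N) (seq x N)))
        (ℚ.+-monoˡ-≤ ℚ.∣ seq x N ∣ (ℚ.<⇒≤ (h n N n≥ ℕ.≤-refl)))

inv>0 : ∀ {B} → 0ℚ ℚ.< B → ∃[ k ] (0ℚ ℚ.< k × B ℚ.* k ≡ 1ℚ)
inv>0 {B} B>0 = (ℚ.1/ B) {{nz}}
  , ℚ.positive⁻¹ ((ℚ.1/ B) {{nz}}) {{ℚ.1/pos⇒pos B {{ℚ.positive B>0}}}}
  , ℚ.*-inverseʳ B {{nz}}
  where nz = ℚ.>-nonZero B>0

*-split : ∀ a b c d → a ℚ.* b ℚ.- c ℚ.* d ≡ a ℚ.* (b ℚ.- d) ℚ.+ d ℚ.* (a ℚ.- c)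
*-split = R.solve 4 (λ a b c d →
  a R.:* b R.:- c R.:* d R.:= a R.:* (b R.:- d) R.:+ d R.:* (a R.:- c)) refl

cancel-inverse : ∀ B k h → B ℚ.* k ≡ 1ℚ → B ℚ.* (h ℚ.* k) ≡ h
cancel-inverse B k h Bk≡1 = begin
  B ℚ.* (h ℚ.* k)  ≡⟨ R.solve 3 (λ B k h → B R.:* (h R.:* k) R.:= h R.:* (B R.:* k)) refl B k h ⟩
  h ℚ.* (B ℚ.* k)  ≡⟨ cong (h ℚ.*_) Bk≡1 ⟩
  h ℚ.* 1ℚ         ≡⟨ ℚ.*-identityʳ h ⟩
  h                ∎
  where open ≡-Reasoning

*-close : ∀ {a b c d B C k l ε} → 0ℚ ℚ.< B → 0ℚ ℚ.< C → B ℚ.* k ≡ 1ℚ → C ℚ.* l ≡ 1ℚ →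
          ℚ.∣ a ∣ ℚ.≤ B → ℚ.∣ d ∣ ℚ.≤ C →
          ℚ.∣ b ℚ.- d ∣ ℚ.< ½ ℚ.* ε ℚ.* k → ℚ.∣ a ℚ.- c ∣ ℚ.< ½ ℚ.* ε ℚ.* l →
          ℚ.∣ a ℚ.* b ℚ.- c ℚ.* d ∣ ℚ.< ε
*-close {a} {b} {c} {d} {B} {C} {k} {l} {ε} B>0 C>0 Bk≡1 Cl≡1 a≤B d≤C b≈d a≈c = ℚ.≤-<-trans
  (subst (λ z → ℚ.∣ z ∣ ℚ.≤ ℚ.∣ a ∣ ℚ.* ℚ.∣ b ℚ.- d ∣ ℚ.+ ℚ.∣ d ∣ ℚ.* ℚ.∣ a ℚ.- c ∣)
    (sym (*-split a b c d))
    (subst (ℚ.∣ a ℚ.* (b ℚ.- d) ℚ.+ d ℚ.* (a ℚ.- c) ∣ ℚ.≤_)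
      (cong₂ ℚ._+_ (ℚ.∣p*q∣≡∣p∣*∣q∣ a (b ℚ.- d)) (ℚ.∣p*q∣≡∣p∣*∣q∣ d (a ℚ.- c)))
      (ℚ.∣p+q∣≤∣p∣+∣q∣ (a ℚ.* (b ℚ.- d)) (d ℚ.* (a ℚ.- c)))))
  (subst (ℚ.∣ a ∣ ℚ.* ℚ.∣ b ℚ.- d ∣ ℚ.+ ℚ.∣ d ∣ ℚ.* ℚ.∣ a ℚ.- c ∣ ℚ.<_)
    (halves ε)
    (ℚ.+-mono-< (term a (b ℚ.- d) {B} {k} {½ ℚ.* ε} B>0 Bk≡1 a≤B b≈d) (term d (a ℚ.- c) {C} {l} {½ ℚ.* ε} C>0 Cl≡1 d≤C a≈c)))
  where
  term : ∀ p q {B k h} → 0ℚ ℚ.< B → B ℚ.* k ≡ 1ℚ → ℚ.∣ p ∣ ℚ.≤ B →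
         ℚ.∣ q ∣ ℚ.< h ℚ.* k → ℚ.∣ p ∣ ℚ.* ℚ.∣ q ∣ ℚ.< h
  term p q {B} {k} {h} B>0 Bk≡1 p≤B q<hk = ℚ.≤-<-trans
    (ℚ.*-monoʳ-≤-nonNeg ℚ.∣ q ∣ {{ℚ.∣-∣-nonNeg q}} p≤B)
    (subst (B ℚ.* ℚ.∣ q ∣ ℚ.<_) (cancel-inverse B k h Bk≡1)
      (ℚ.*-monoʳ-<-pos B {{ℚ.positive B>0}} q<hk))

abstract
  *-cauchy : ∀ x y → Cauchy (λ n → seq x n ℚ.* seq y n)
  *-cauchy x y ε ε>0 =
    let B , B>0 , N₁ , b  = eventually-bounded x
        C , C>0 , N₂ , c  = eventually-bounded y
        k , k>0 , Bk≡1    = inv>0 B>0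
        l , l>0 , Cl≡1    = inv>0 C>0
        N₃ , f            = cauchy x (½ ℚ.* ε ℚ.* l) (*>0 (half>0 ε>0) l>0)
        N₄ , g            = cauchy y (½ ℚ.* ε ℚ.* k) (*>0 (half>0 ε>0) k>0)
        N₁₂               = N₁ ℕ.⊔ N₂
        N₃₄               = N₃ ℕ.⊔ N₄
    in N₁₂ ℕ.⊔ N₃₄ , λ m n m≥ n≥ →
      let m≥₁₂ = ℕ.m⊔n≤o⇒m≤o N₁₂ N₃₄ m≥
          n≥₁₂ = ℕ.m⊔n≤o⇒m≤o N₁₂ N₃₄ n≥
          m≥₃₄ = ℕ.m⊔n≤o⇒n≤o N₁₂ N₃₄ m≥
          n≥₃₄ = ℕ.m⊔n≤o⇒n≤o N₁₂ N₃₄ n≥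
      in *-close {seq x m} {seq y m} {seq x n} {seq y n} {B} {C} {k} {l} {ε} B>0 C>0 Bk≡1 Cl≡1
           (b m (ℕ.m⊔n≤o⇒m≤o N₁ N₂ m≥₁₂))
           (c n (ℕ.m⊔n≤o⇒n≤o N₁ N₂ n≥₁₂))
           (g m n (ℕ.m⊔n≤o⇒n≤o N₃ N₄ m≥₃₄) (ℕ.m⊔n≤o⇒n≤o N₃ N₄ n≥₃₄))
           (f m n (ℕ.m⊔n≤o⇒m≤o N₃ N₄ m≥₃₄) (ℕ.m⊔n≤o⇒m≤o N₃ N₄ n≥₃₄))

_*_ : ℝ → ℝ → ℝ
x * y = mkℝ (λ n → seq x n ℚ.* seq y n) (*-cauchy x y)

_^_ : ℝ → ℕ → ℝ
x ^ zero  = 1ℝ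
x ^ suc k = x * x ^ k

∣p∣-∣q∣≤∣p-q∣ : ∀ p q → ℚ.∣ p ∣ ℚ.- ℚ.∣ q ∣ ℚ.≤ ℚ.∣ p ℚ.- q ∣
∣p∣-∣q∣≤∣p-q∣ p q = subst (ℚ.∣ p ∣ ℚ.- ℚ.∣ q ∣ ℚ.≤_)
  (R.solve 2 (λ a b → (a R.:+ b) R.:- b R.:= a) refl ℚ.∣ p ℚ.- q ∣ ℚ.∣ q ∣)
  (ℚ.+-monoˡ-≤ (ℚ.- ℚ.∣ q ∣)
    (subst (λ z → ℚ.∣ z ∣ ℚ.≤ ℚ.∣ p ℚ.- q ∣ ℚ.+ ℚ.∣ q ∣)
      (R.solve 2 (λ a b → (a R.:- b) R.:+ b R.:= a) refl p q)
      (ℚ.∣p+q∣≤∣p∣+∣q∣ (p ℚ.- q) q)))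

∣∣p∣-∣q∣∣≤∣p-q∣ : ∀ p q → ℚ.∣ ℚ.∣ p ∣ ℚ.- ℚ.∣ q ∣ ∣ ℚ.≤ ℚ.∣ p ℚ.- q ∣
∣∣p∣-∣q∣∣≤∣p-q∣ p q with ℚ.∣p∣≡p∨∣p∣≡-p (ℚ.∣ p ∣ ℚ.- ℚ.∣ q ∣)
... | inj₁ e = subst (ℚ._≤ ℚ.∣ p ℚ.- q ∣) (sym e) (∣p∣-∣q∣≤∣p-q∣ p q)
... | inj₂ e = subst₂ ℚ._≤_
    (trans (R.solve 2 (λ a b → b R.:- a R.:= R.:- (a R.:- b)) refl ℚ.∣ p ∣ ℚ.∣ q ∣) (sym e))
    (∣-∣-swap q p) (∣p∣-∣q∣≤∣p-q∣ q p)

abstract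
  ∣∣-cauchy : ∀ x → Cauchy (λ n → ℚ.∣ seq x n ∣)
  ∣∣-cauchy x ε ε>0 =
    let N , h = cauchy x ε ε>0
    in N , λ m n m≥ n≥ → ℚ.≤-<-trans (∣∣p∣-∣q∣∣≤∣p-q∣ (seq x m) (seq x n)) (h m n m≥ n≥)

∣_∣ : ℝ → ℝ
∣ x ∣ = mkℝ (λ n → ℚ.∣ seq x n ∣) (∣∣-cauchy x)

recipℚ : ℚ → ℚ
recipℚ q with q ℚ.≟ 0ℚ
... | yes _   = 0ℚ
... | no  q≢0 = (ℚ.1/ q) {{ℚ.≢-nonZero q≢0}}

recipℚ-inverse : ∀ {q} → 0ℚ ℚ.< q → q ℚ.* recipℚ q ≡ 1ℚ
recipℚ-inverse {q} q>0 with q ℚ.≟ 0ℚ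
... | yes q≡0 = contradiction (sym q≡0) (ℚ.<⇒≢ q>0)
... | no  q≢0 = ℚ.*-inverseʳ q {{ℚ.≢-nonZero q≢0}}

inverse-bound : ∀ {a u δ k} → 0ℚ ℚ.< δ → 0ℚ ℚ.≤ k → δ ℚ.* k ≡ 1ℚ →
                δ ℚ.≤ a → a ℚ.* u ≡ 1ℚ → ℚ.∣ u ∣ ℚ.≤ k
inverse-bound {a} {u} {δ} {k} δ>0 k≥0 δk≡1 δ≤a au≡1 =
  subst₂ ℚ._≤_ (cancel-inverse δ k ℚ.∣ u ∣ δk≡1) (cancel-inverse ℚ.∣ a ∣ ℚ.∣ u ∣ k ∣a∣∣u∣≡1)
    (subst (ℚ._≤ ℚ.∣ a ∣ ℚ.* (k ℚ.* ℚ.∣ u ∣)) (cong (δ ℚ.*_) (ℚ.*-comm k ℚ.∣ u ∣))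
      (subst (λ z → δ ℚ.* (k ℚ.* ℚ.∣ u ∣) ℚ.≤ z ℚ.* (k ℚ.* ℚ.∣ u ∣))
        (sym (ℚ.0≤p⇒∣p∣≡p (ℚ.≤-trans (ℚ.<⇒≤ δ>0) δ≤a)))
        (ℚ.*-monoʳ-≤-nonNeg (k ℚ.* ℚ.∣ u ∣) {{ℚ.nonNegative k∣u∣≥0}} δ≤a)))
  where
  ∣a∣∣u∣≡1 : ℚ.∣ a ∣ ℚ.* ℚ.∣ u ∣ ≡ 1ℚ
  ∣a∣∣u∣≡1 = trans (sym (ℚ.∣p*q∣≡∣p∣*∣q∣ a u)) (cong ℚ.∣_∣ au≡1)

  k∣u∣≥0 : 0ℚ ℚ.≤ k ℚ.* ℚ.∣ u ∣
  k∣u∣≥0 = subst (ℚ._≤ k ℚ.* ℚ.∣ u ∣) (ℚ.*-zeroʳ k)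
    (ℚ.*-monoˡ-≤-nonNeg k {{ℚ.nonNegative k≥0}} (ℚ.0≤∣p∣ u))

inverse-difference : ∀ a b u v → a ℚ.* u ≡ 1ℚ → b ℚ.* v ≡ 1ℚ → u ℚ.- v ≡ u ℚ.* (v ℚ.* (b ℚ.- a))
inverse-difference a b u v au≡1 bv≡1 = begin
  u ℚ.- v
    ≡⟨ cong₂ ℚ._-_ (sym (cancel-inverse b v u bv≡1)) (sym (cancel-inverse a u v au≡1)) ⟩
  b ℚ.* (u ℚ.* v) ℚ.- a ℚ.* (v ℚ.* u)
    ≡⟨ R.solve 4 (λ a b u v → b R.:* (u R.:* v) R.:- a R.:* (v R.:* u) R.:=
         u R.:* (v R.:* (b R.:- a))) refl a b u v ⟩
  u ℚ.* (v ℚ.* (b ℚ.- a)) ∎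
  where open ≡-Reasoning

inverse-close : ∀ {a b u v δ k ε} → 0ℚ ℚ.< δ → 0ℚ ℚ.< k → δ ℚ.* k ≡ 1ℚ →
                δ ℚ.≤ a → δ ℚ.≤ b → a ℚ.* u ≡ 1ℚ → b ℚ.* v ≡ 1ℚ →
                ℚ.∣ a ℚ.- b ∣ ℚ.< ε ℚ.* δ ℚ.* δ → ℚ.∣ u ℚ.- v ∣ ℚ.< ε
inverse-close {a} {b} {u} {v} {δ} {k} {ε} δ>0 k>0 δk≡1 δ≤a δ≤b au≡1 bv≡1 a≈b =
  ℚ.≤-<-trans (ℚ.≤-trans (ℚ.≤-reflexive expand) outer)
    (subst (k ℚ.* (k ℚ.* ℚ.∣ b ℚ.- a ∣) ℚ.<_) cancel
      (ℚ.*-monoʳ-<-pos k {{ℚ.positive k>0}} (ℚ.*-monoʳ-<-pos k {{ℚ.positive k>0}}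
        (subst (ℚ._< ε ℚ.* δ ℚ.* δ) (∣-∣-swap a b) a≈b))))
  where
  w = ℚ.∣ b ℚ.- a ∣

  k≥0 : 0ℚ ℚ.≤ k
  k≥0 = ℚ.<⇒≤ k>0

  expand : ℚ.∣ u ℚ.- v ∣ ≡ ℚ.∣ u ∣ ℚ.* (ℚ.∣ v ∣ ℚ.* w)
  expand = trans (cong ℚ.∣_∣ (inverse-difference a b u v au≡1 bv≡1))
    (trans (ℚ.∣p*q∣≡∣p∣*∣q∣ u (v ℚ.* (b ℚ.- a)))
      (cong (ℚ.∣ u ∣ ℚ.*_) (ℚ.∣p*q∣≡∣p∣*∣q∣ v (b ℚ.- a))))

  ∣v∣w≥0 : 0ℚ ℚ.≤ ℚ.∣ v ∣ ℚ.* w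
  ∣v∣w≥0 = subst (0ℚ ℚ.≤_) (ℚ.∣p*q∣≡∣p∣*∣q∣ v (b ℚ.- a)) (ℚ.0≤∣p∣ (v ℚ.* (b ℚ.- a)))

  outer : ℚ.∣ u ∣ ℚ.* (ℚ.∣ v ∣ ℚ.* w) ℚ.≤ k ℚ.* (k ℚ.* w)
  outer = *-mono-≤-nonNeg {ℚ.∣ u ∣} {k} {ℚ.∣ v ∣ ℚ.* w} {k ℚ.* w} ∣v∣w≥0 k≥0
    (inverse-bound {a} {u} {δ} {k} δ>0 k≥0 δk≡1 δ≤a au≡1)
    (ℚ.*-monoʳ-≤-nonNeg w {{ℚ.∣-∣-nonNeg (b ℚ.- a)}}
      (inverse-bound {b} {v} {δ} {k} δ>0 k≥0 δk≡1 δ≤b bv≡1))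

  kδ≡1 : k ℚ.* δ ≡ 1ℚ
  kδ≡1 = trans (ℚ.*-comm k δ) δk≡1

  cancel : k ℚ.* (k ℚ.* (ε ℚ.* δ ℚ.* δ)) ≡ ε
  cancel = trans (cong (k ℚ.*_) (cancel-inverse k δ (ε ℚ.* δ) kδ≡1)) (cancel-inverse k δ ε kδ≡1)

abstract
  recip-cauchy : ∀ x → 0ℝ < x → Cauchy (λ n → recipℚ (seq x n))
  recip-cauchy x (δ , δ>0 , N₁ , low) ε ε>0 =
    let k , k>0 , δk≡1 = inv>0 δ>0
        N₂ , f         = cauchy x (ε ℚ.* δ ℚ.* δ) (*>0 (*>0 ε>0 δ>0) δ>0)
    in N₁ ℕ.⊔ N₂ , λ m n m≥ n≥ →
      let m≥₁ = ℕ.m⊔n≤o⇒m≤o N₁ N₂ m≥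
          n≥₁ = ℕ.m⊔n≤o⇒m≤o N₁ N₂ n≥
      in inverse-close {seq x m} {seq x n} {recipℚ (seq x m)} {recipℚ (seq x n)} {δ} {k} {ε}
           δ>0 k>0 δk≡1 (δ≤ m m≥₁) (δ≤ n n≥₁) (inverse m m≥₁) (inverse n n≥₁)
           (f m n (ℕ.m⊔n≤o⇒n≤o N₁ N₂ m≥) (ℕ.m⊔n≤o⇒n≤o N₁ N₂ n≥))
    where
    δ≤ : ∀ n → N₁ ℕ.≤ n → δ ℚ.≤ seq x n
    δ≤ n n≥ = subst (ℚ._≤ seq x n) (ℚ.+-identityˡ δ) (low n n≥)

    inverse : ∀ n → N₁ ℕ.≤ n → seq x n ℚ.* recipℚ (seq x n) ≡ 1ℚ
    inverse n n≥ = recipℚ-inverse (ℚ.<-≤-trans δ>0 (δ≤ n n≥))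

recip : (x : ℝ) → 0ℝ < x → ℝ
recip x x>0 = mkℝ (λ n → recipℚ (seq x n)) (recip-cauchy x x>0)

p≤∣p∣ : ∀ p → p ℚ.≤ ℚ.∣ p ∣
p≤∣p∣ p with ℚ.≤-total 0ℚ p
... | inj₁ 0≤p = ℚ.≤-reflexive (sym (ℚ.0≤p⇒∣p∣≡p 0≤p))
... | inj₂ p≤0 = ℚ.≤-trans p≤0 (ℚ.0≤∣p∣ p)

p+ε≤q⇒ε≤∣q-p∣ : ∀ p q ε → p ℚ.+ ε ℚ.≤ q → 0ℚ ℚ.+ ε ℚ.≤ ℚ.∣ q ℚ.- p ∣
p+ε≤q⇒ε≤∣q-p∣ p q ε h = ℚ.≤-trans
  (subst (ℚ._≤ q ℚ.- p) (trans cancel (sym (ℚ.+-identityˡ ε))) (ℚ.+-monoˡ-≤ (ℚ.- p) h))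
  (p≤∣p∣ (q ℚ.- p))
  where
  cancel : p ℚ.+ ε ℚ.- p ≡ ε
  cancel = R.solve 2 (λ p ε → p R.:+ ε R.:- p R.:= ε) refl p ε

#⇒0<∣-∣ : ∀ x y → x # y → 0ℝ < ∣ x - y ∣
#⇒0<∣-∣ x y (inj₁ (ε , ε>0 , N , h)) = ε , ε>0 , N , λ n n≥ →
  subst (0ℚ ℚ.+ ε ℚ.≤_) (∣-∣-swap (seq y n) (seq x n)) (p+ε≤q⇒ε≤∣q-p∣ (seq x n) (seq y n) ε (h n n≥))
#⇒0<∣-∣ x y (inj₂ (ε , ε>0 , N , h)) = ε , ε>0 , N , λ n n≥ →
  p+ε≤q⇒ε≤∣q-p∣ (seq y n) (seq x n) ε (h n n≥)

-- IsPower b s y says that y = b ^ s, for a base b ≥ 1 and a real exponent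
-- s > 0: b ^ s is the positive real with b ^ r ≤ b ^ s ≤ b ^ r′ for all
-- rationals r < s < r′, where b ^ (p / q) ≤ y means b ^ p ≤ y ^ q.
record IsPower (b s y : ℝ) : Set where
  field
    positive : 0ℝ < y
    lower    : ∀ p q .{{_ : ℕ.NonZero q}} →
               fromℚ (ℤ.+ p ℚ./ q) < s → b ^ p ≤ y ^ q
    upper    : ∀ p q .{{_ : ℕ.NonZero q}} →
               s < fromℚ (ℤ.+ p ℚ./ q) → y ^ q ≤ b ^ p

-- Polynomials, as lists of coefficients starting from the constant term;
-- trailing zeros are allowed

coeffℤ : List ℤ → ℕ → ℤ
coeffℤ []      _       = ℤ.0ℤ
coeffℤ (a ∷ _) zero    = a
coeffℤ (_ ∷ f) (suc i) = coeffℤ f i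

coeffℚ : List ℚ → ℕ → ℚ
coeffℚ []      _       = 0ℚ
coeffℚ (a ∷ _) zero    = a
coeffℚ (_ ∷ f) (suc i) = coeffℚ f i

infixl 6 _+ₚ_
infixl 7 _*ₚ_

_+ₚ_ : List ℚ → List ℚ → List ℚ
[]      +ₚ g       = g
(a ∷ f) +ₚ []      = a ∷ f
(a ∷ f) +ₚ (b ∷ g) = a ℚ.+ b ∷ f +ₚ g

_*ₚ_ : List ℚ → List ℚ → List ℚ
[]      *ₚ g = []
(a ∷ f) *ₚ g = map (a ℚ.*_) g +ₚ (0ℚ ∷ f *ₚ g)

ℚ[t] : RawSemiring 0ℓ 0ℓ
ℚ[t] = record
  { Carrier = List ℚ
  ; _≈_ = λ f g → ∀ i → coeffℚ f i ≡ coeffℚ g i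
  ; _+_ = _+ₚ_
  ; _*_ = _*ₚ_
  ; 0#  = []
  ; 1#  = 1ℚ ∷ []
  }

import Algebra.Definitions.RawSemiring ℚ[t] as ℚ[t]

IrreducibleOverℚ : List ℤ → Set
IrreducibleOverℚ P = ℚ[t].Irreducible (map (λ a → a ℚ./ 1) P)

MonicOfDegree : ℕ → List ℤ → Set
MonicOfDegree n P = coeffℤ P n ≡ ℤ.1ℤ × (∀ i → n ℕ.< i → coeffℤ P i ≡ ℤ.0ℤ)

height : List ℤ → ℕ
height = foldr (λ a h → ℤ.∣ a ∣ ℕ.⊔ h) 0

eval : List ℤ → ℝ → ℝ
eval P x = foldr (λ a v → fromℤ a + x * v) 0ℝ P

record IsMinimalPolynomial (n : ℕ) (P : List ℤ) (α : ℝ × ℝ) : Set where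
  field
    monic       : MonicOfDegree n P
    irreducible : IrreducibleOverℚ P
    root₁       : eval P (proj₁ α) ≈ 0ℝ
    root₂       : eval P (proj₂ α) ≈ 0ℝ

-- Only points of ℝ² are considered, since the set is only ever intersected
-- with rectangles in ℝ². A minimal polynomial is unique, so its degree and
-- height are those of the point.
Ã² : ℕ → ℝ → Pred (ℝ × ℝ) 0ℓ
Ã² n Q α = ∃[ P ] (IsMinimalPolynomial n P α × fromℕ (height P) ≤ Q)

record Interval : Set where
  constructor [_,_]ᵢ
  field
    lo hi : ℝ

open Interval public

length₁ : Interval → ℝ
length₁ I = hi I - lo I

midpoint : Interval → ℝ
midpoint I = fromℚ ½ * (lo I + hi I)

-- Intervals are closed, so an upper bound for the number of points also
-- covers the open and half-open intervals with the same endpoints.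
_∈ᵢ_ : ℝ → Interval → Set
x ∈ᵢ I = lo I ≤ x × x ≤ hi I

rectangle : Interval → Interval → Pred (ℝ × ℝ) 0ℓ
rectangle I₁ I₂ (x , y) = x ∈ᵢ I₁ × y ∈ᵢ I₂

-- Lebesgue measure of the rectangle I₁ × I₂
area : Interval → Interval → ℝ
area I₁ I₂ = length₁ I₁ * length₁ I₂

ℝ²-setoid : Setoid 0ℓ 0ℓ
ℝ²-setoid = ×-setoid ℝ-setoid ℝ-setoid

open UniqueSetoid ℝ²-setoid public using (Unique)

-- "S is finite and # S < B": any list of pairwise distinct elements of S
-- has fewer than B entries.
infix 4 #_<_

#_<_ : Pred (ℝ × ℝ) 0ℓ → ℝ → Set
# S < B = ∀ xs → Unique xs → All S xs → fromℕ (length xs) < B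

-- IsRho n x r says that r = ρₙ(x). The two clauses determine r, but
-- x ≈ 0 is undecidable, so ρₙ cannot be defined by the case distinction.
record IsRho (n : ℕ) (x r : ℝ) : Set where
  field
    off-zero : (∣x∣>0 : 0ℝ < ∣ x ∣) →
               r ≈ ((∣ x ∣ + 1ℝ) ^ (n ℕ.+ 1) - 1ℝ) * recip ∣ x ∣ ∣x∣>0
    at-zero  : x ≈ 0ℝ → r ≈ fromℕ (n ℕ.+ 1)

-- ρ₁ and ρ₂ stand for ρₙ(d₁) and ρₙ(d₂)
c₇ : (n : ℕ) (ρ₁ ρ₂ d₁ d₂ : ℝ) → d₁ # d₂ → ℝ
c₇ n ρ₁ ρ₂ d₁ d₂ d₁#d₂ =
  fromℕ (2 ℕ.^ (3 ℕ.* n ℕ.+ 8) ℕ.* n ℕ.^ 2) * ρ₁ * ρ₂ *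
  recip ∣ d₁ - d₂ ∣ (#⇒0<∣-∣ d₁ d₂ d₁#d₂)

{-# OPTIONS --safe #-}
module Submission where

-- A monic P of degree n and height at most Q with a root α near d satisfies
-- |P(d)| ≤ |α − d| Q ρₙ(d). So two such polynomials with roots in both sides of the
-- rectangle differ at dᵢ by at most Lᵢ = μ₁(Iᵢ) Q ρₙ(dᵢ). Once the coefficients of
-- t², …, tⁿ⁻¹ are fixed, in at most (8Q)ⁿ⁻² ways, the differences at d₁ and d₂ determine
-- those of the last two coefficients: the linear coefficient varies by at most
-- (L₁ + L₂) / |d₁ − d₂| and then the constant one by at most min(L₁, L₂). For large Q all
-- of these are at least 1, so rounding costs only a constant factor and there are at most
-- 15 · 8ⁿ⁻² Qⁿ⁻² L₁ L₂ / |d₁ − d₂| polynomials, each with at most n² pairs of real roots.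
-- The resulting bound is strictly smaller than the claimed one, and "length ≤ bound" is a
-- negated statement, so that it may be proved with classical case distinctions.

open import Algebra.Bundles using (module AbelianGroup)
open import Data.Empty using (⊥-elim)
open import Data.Integer.Base as ℤ using (ℤ)
import Data.Integer.Properties as ℤ
open import Algebra.Properties.Group (AbelianGroup.group ℤ.+-0-abelianGroup) using (∙-cancelˡ)
open import Data.List.Base using (List; []; _∷_; length; drop)
open import Data.List.Relation.Binary.Sublist.Propositional using (_⊆_; []; _∷_; _∷ʳ_; ⊆-trans)
open import Data.List.Relation.Binary.Sublist.Propositional.Properties using (All-resp-⊆)
open import Data.List.Relation.Unary.All as All using (All; []; _∷_)
open import Data.List.Relation.Unary.AllPairs as AllPairs using (AllPairs; []; _∷_)
open import Data.Nat.Base as ℕ using (ℕ; zero; suc)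
import Data.Nat.Properties as ℕ
open import Data.Product.Base using (_×_; _,_; proj₁; proj₂; ∃-syntax)
open import Data.Rational.Base as ℚ using (ℚ; 0ℚ; 1ℚ; ½)
import Data.Rational.Properties as ℚ
import Data.Rational.Solver as ℚSolver
import Data.Rational.Unnormalised.Base as ℚᵘ
import Data.Rational.Unnormalised.Properties as ℚᵘ
open import Data.Sum.Base as Sum using (_⊎_; inj₁; inj₂; [_,_]′)
open import Function.Base using (id)
open import Level using (0ℓ)
open import Relation.Binary.Bundles using (Setoid)
open import Relation.Binary.Core using (Rel)
open import Relation.Binary.PropositionalEquality using (_≡_; refl; sym; trans; cong; cong₂; subst; subst₂)
open import Relation.Binary.Structures using (IsPreorder)
open import Relation.Nullary using (¬_; yes; no)
open import Relation.Unary using (Pred; ∁; _∩_)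
open import Defs

-- The two conditions on γ act in opposite directions. From γ > 0 the sides shrink below 1, so a
-- root α near d has |α| ≤ |d| + 1, and this is what makes ρₙ(d) the right constant. From γ < 1 the
-- products μ₁(Iᵢ) Q grow without bound, so a count 2L + 1 of integers can be replaced by a multiple
-- of L.
--
-- Equality and order of reals cannot be decided, so points cannot be sorted into classes by a
-- program. Instead a class is described by a relation between its members, and the lengths of lists
-- of pairwise related points are bounded. Fixing one more coefficient or root strengthens the
-- relation, and the lists are split only under a double negation.
--
-- The factor 15 is 5 · 3, for the linear and the constant coefficient. Each further coefficient
-- costs at most 5Q, rounded up to 8Q so that the powers of 2 match those in `c₇`.

private module ℚR = ℚSolver.+-*-Solver

-- Rational inequalities

0≤q-p : ∀ {p q} → p ℚ.≤ q → 0ℚ ℚ.≤ q ℚ.- p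
0≤q-p {p} {q} p≤q = subst (ℚ._≤ q ℚ.- p) (ℚ.+-inverseʳ p) (ℚ.+-monoˡ-≤ (ℚ.- p) p≤q)

-- Stands in for linear arithmetic: known nonnegative quantities are summed to `s`, and the ring
-- solver checks that the sum is the required difference.
≤-from-difference : ∀ {p q s} → 0ℚ ℚ.≤ s → s ≡ q ℚ.- p → p ℚ.≤ q
≤-from-difference {p} {q} 0≤s refl = subst₂ ℚ._≤_ (ℚ.+-identityˡ p)
  (ℚR.solve 2 (λ p q → (q ℚR.:- p) ℚR.:+ p ℚR.:= q) refl p q) (ℚ.+-monoˡ-≤ p 0≤s)

0≤+ : ∀ {p q} → 0ℚ ℚ.≤ p → 0ℚ ℚ.≤ q → 0ℚ ℚ.≤ p ℚ.+ q
0≤+ = ℚ.+-mono-≤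

0≤b+ε-a : ∀ a b {ε} → ℚ.∣ a ℚ.- b ∣ ℚ.< ε → 0ℚ ℚ.≤ b ℚ.+ ε ℚ.- a
0≤b+ε-a a b {ε} h = subst (0ℚ ℚ.≤_)
  (ℚR.solve 3 (λ a b ε → ε ℚR.:- (a ℚR.:- b) ℚR.:= b ℚR.:+ ε ℚR.:- a) refl a b ε)
  (0≤q-p (ℚ.≤-trans (p≤∣p∣ (a ℚ.- b)) (ℚ.<⇒≤ h)))

0≤a+ε-b : ∀ a b {ε} → ℚ.∣ a ℚ.- b ∣ ℚ.< ε → 0ℚ ℚ.≤ a ℚ.+ ε ℚ.- b
0≤a+ε-b a b {ε} h = 0≤b+ε-a b a (subst (ℚ._< ε) (∣-∣-swap a b) h)

0≤* : ∀ {p q} → 0ℚ ℚ.≤ p → 0ℚ ℚ.≤ q → 0ℚ ℚ.≤ p ℚ.* q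
0≤* {p} {q} 0≤p 0≤q = subst (ℚ._≤ p ℚ.* q) (ℚ.*-zeroʳ p) (ℚ.*-monoˡ-≤-nonNeg p {{ℚ.nonNegative 0≤p}} 0≤q)

/1-homo-+ : ∀ a b → (a ℤ.+ b) ℚ./ 1 ≡ a ℚ./ 1 ℚ.+ b ℚ./ 1
/1-homo-+ a b = ℚ.toℚᵘ-injective (begin
  ℚ.toℚᵘ ((a ℤ.+ b) ℚ./ 1)                     ≈⟨ ℚ.toℚᵘ-fromℚᵘ (ℚᵘ.mkℚᵘ (a ℤ.+ b) 0) ⟩
  ℚᵘ.mkℚᵘ (a ℤ.+ b) 0                          ≈⟨ ℚᵘ.*≡* (cong (ℤ._* ℤ.+ 1) (sym (cong₂ ℤ._+_ (ℤ.*-identityʳ a) (ℤ.*-identityʳ b)))) ⟩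
  ℚᵘ.mkℚᵘ a 0 ℚᵘ.+ ℚᵘ.mkℚᵘ b 0                 ≈⟨ ℚᵘ.+-cong (ℚ.toℚᵘ-fromℚᵘ (ℚᵘ.mkℚᵘ a 0)) (ℚ.toℚᵘ-fromℚᵘ (ℚᵘ.mkℚᵘ b 0)) ⟨
  ℚ.toℚᵘ (a ℚ./ 1) ℚᵘ.+ ℚ.toℚᵘ (b ℚ./ 1)       ≈⟨ ℚ.toℚᵘ-homo-+ (a ℚ./ 1) (b ℚ./ 1) ⟨
  ℚ.toℚᵘ (a ℚ./ 1 ℚ.+ b ℚ./ 1)                 ∎)
  where open ℚᵘ.≃-Reasoning

/1-homo-* : ∀ a b → (a ℤ.* b) ℚ./ 1 ≡ a ℚ./ 1 ℚ.* (b ℚ./ 1)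
/1-homo-* a b = ℚ.toℚᵘ-injective (begin
  ℚ.toℚᵘ ((a ℤ.* b) ℚ./ 1)                     ≈⟨ ℚ.toℚᵘ-fromℚᵘ (ℚᵘ.mkℚᵘ (a ℤ.* b) 0) ⟩
  ℚᵘ.mkℚᵘ a 0 ℚᵘ.* ℚᵘ.mkℚᵘ b 0                 ≈⟨ ℚᵘ.*-cong (ℚ.toℚᵘ-fromℚᵘ (ℚᵘ.mkℚᵘ a 0)) (ℚ.toℚᵘ-fromℚᵘ (ℚᵘ.mkℚᵘ b 0)) ⟨
  ℚ.toℚᵘ (a ℚ./ 1) ℚᵘ.* ℚ.toℚᵘ (b ℚ./ 1)       ≈⟨ ℚ.toℚᵘ-homo-* (a ℚ./ 1) (b ℚ./ 1) ⟨
  ℚ.toℚᵘ (a ℚ./ 1 ℚ.* (b ℚ./ 1))               ∎)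
  where open ℚᵘ.≃-Reasoning

/1-homo-neg : ∀ a → (ℤ.- a) ℚ./ 1 ≡ ℚ.- (a ℚ./ 1)
/1-homo-neg a = ℚ.toℚᵘ-injective (begin
  ℚ.toℚᵘ ((ℤ.- a) ℚ./ 1)                       ≈⟨ ℚ.toℚᵘ-fromℚᵘ (ℚᵘ.mkℚᵘ (ℤ.- a) 0) ⟩
  ℚᵘ.- ℚᵘ.mkℚᵘ a 0                             ≈⟨ ℚᵘ.-‿cong (ℚ.toℚᵘ-fromℚᵘ (ℚᵘ.mkℚᵘ a 0)) ⟨
  ℚᵘ.- ℚ.toℚᵘ (a ℚ./ 1)                        ≈⟨ ℚ.toℚᵘ-homo‿- (a ℚ./ 1) ⟨
  ℚ.toℚᵘ (ℚ.- (a ℚ./ 1))                       ∎)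
  where open ℚᵘ.≃-Reasoning

0≤k/1 : ∀ k → 0ℚ ℚ.≤ ℤ.+ k ℚ./ 1
0≤k/1 k = ℚ.nonNegative⁻¹ (ℤ.+ k ℚ./ 1) {{ℚ.normalize-nonNeg k 1}}

/1-homo-∣∣ : ∀ a → ℤ.+ ℤ.∣ a ∣ ℚ./ 1 ≡ ℚ.∣ a ℚ./ 1 ∣
/1-homo-∣∣ (ℤ.+ k)    = sym (ℚ.0≤p⇒∣p∣≡p (0≤k/1 k))
/1-homo-∣∣ ℤ.-[1+ k ] = sym (trans (cong ℚ.∣_∣ (/1-homo-neg (ℤ.+ suc k)))
  (trans (ℚ.∣-p∣≡∣p∣ (ℤ.+ suc k ℚ./ 1)) (ℚ.0≤p⇒∣p∣≡p (0≤k/1 (suc k)))))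

-- The order on ℝ

eighth : ∀ ε → 0ℚ ℚ.< ε →
         ∃[ η ] (0ℚ ℚ.< η × ((η ℚ.+ η) ℚ.+ (η ℚ.+ η)) ℚ.+ ((η ℚ.+ η) ℚ.+ (η ℚ.+ η)) ≡ ε)
eighth ε ε>0 = ½ ℚ.* (½ ℚ.* (½ ℚ.* ε)) , half>0 (half>0 (half>0 ε>0)) ,
  trans (cong₂ ℚ._+_ quarter quarter) (halves ε)
  where
  quarter = trans (cong₂ ℚ._+_ (halves (½ ℚ.* (½ ℚ.* ε))) (halves (½ ℚ.* (½ ℚ.* ε)))) (halves (½ ℚ.* ε))

-- The usable substitute for trichotomy. One comparison of rationals at a late index M decides: the
-- threshold X + 4η lies midway in the gap of 8η between x and z, and the later drift of x and y, at
-- most η each, leaves room on either side.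
<-cotrans : ∀ {x z} → x < z → ∀ y → x < y ⊎ y < z
<-cotrans {x} {z} (ε , ε>0 , N₁ , h) y =
  [ (λ le → inj₁ (above le)) , (λ le → inj₂ (below le)) ]′ (ℚ.≤-total (X ℚ.+ 4η) Y)
  where
  η   = proj₁ (eighth ε ε>0)
  η>0 = proj₁ (proj₂ (eighth ε ε>0))
  8η≡ε = proj₂ (proj₂ (eighth ε ε>0))
  4η  = (η ℚ.+ η) ℚ.+ (η ℚ.+ η)
  N₂ = proj₁ (cauchy x η η>0)
  f  = proj₂ (cauchy x η η>0)
  N₃ = proj₁ (cauchy y η η>0)
  g  = proj₂ (cauchy y η η>0)
  M  = N₁ ℕ.⊔ (N₂ ℕ.⊔ N₃)
  ≥₁ : ∀ {n} → M ℕ.≤ n → N₁ ℕ.≤ n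
  ≥₁ = ℕ.m⊔n≤o⇒m≤o N₁ (N₂ ℕ.⊔ N₃)
  ≥₂ : ∀ {n} → M ℕ.≤ n → N₂ ℕ.≤ n
  ≥₂ le = ℕ.m⊔n≤o⇒m≤o N₂ N₃ (ℕ.m⊔n≤o⇒n≤o N₁ (N₂ ℕ.⊔ N₃) le)
  ≥₃ : ∀ {n} → M ℕ.≤ n → N₃ ℕ.≤ n
  ≥₃ le = ℕ.m⊔n≤o⇒n≤o N₂ N₃ (ℕ.m⊔n≤o⇒n≤o N₁ (N₂ ℕ.⊔ N₃) le)
  X = seq x M
  Y = seq y M
  closeˣ : ∀ n → M ℕ.≤ n → ℚ.∣ X ℚ.- seq x n ∣ ℚ.< η
  closeˣ n le = f M n (≥₂ ℕ.≤-refl) (≥₂ le)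
  closeʸ : ∀ n → M ℕ.≤ n → ℚ.∣ Y ℚ.- seq y n ∣ ℚ.< η
  closeʸ n le = g M n (≥₃ ℕ.≤-refl) (≥₃ le)
  above : X ℚ.+ 4η ℚ.≤ Y → x < y
  above le = (η , η>0 , M , λ n n≥ → ≤-from-difference
        (0≤+ (0≤+ (0≤+ (0≤q-p le) (0≤a+ε-b X (seq x n) (closeˣ n n≥))) (0≤b+ε-a Y (seq y n) (closeʸ n n≥))) (ℚ.<⇒≤ η>0))
        (ℚR.solve 5 (λ X Y a b η →
          (Y ℚR.:- (X ℚR.:+ ((η ℚR.:+ η) ℚR.:+ (η ℚR.:+ η)))) ℚR.:+ (X ℚR.:+ η ℚR.:- a) ℚR.:+ (b ℚR.:+ η ℚR.:- Y) ℚR.:+ η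
          ℚR.:= b ℚR.:- (a ℚR.:+ η)) refl X Y (seq x n) (seq y n) η))
  below : Y ℚ.≤ X ℚ.+ 4η → y < z
  below le = (η , η>0 , M , λ n n≥ → ≤-from-difference
        (0≤+ (0≤+ (0≤+ (0≤+ (0≤q-p le) (0≤b+ε-a X (seq x n) (closeˣ n n≥))) (0≤a+ε-b Y (seq y n) (closeʸ n n≥)))
          (0≤q-p (subst (λ e → seq x n ℚ.+ e ℚ.≤ seq z n) (sym 8η≡ε) (h n (≥₁ n≥))))) (ℚ.<⇒≤ η>0))
        (ℚR.solve 6 (λ X Y a b c η →
          ((X ℚR.:+ ((η ℚR.:+ η) ℚR.:+ (η ℚR.:+ η))) ℚR.:- Y) ℚR.:+ (a ℚR.:+ η ℚR.:- X) ℚR.:+ (Y ℚR.:+ η ℚR.:- b) ℚR.:+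
          (c ℚR.:- (a ℚR.:+ (((η ℚR.:+ η) ℚR.:+ (η ℚR.:+ η)) ℚR.:+ ((η ℚR.:+ η) ℚR.:+ (η ℚR.:+ η))))) ℚR.:+ η
          ℚR.:= c ℚR.:- (b ℚR.:+ η)) refl X Y (seq x n) (seq y n) (seq z n) η))

≈⇒≮ : ∀ {x y} → x ≈ y → ¬ (x < y)
≈⇒≮ {x} {y} x≈y (ε , ε>0 , N , h) with x≈y ε ε>0
... | M , k = ℚ.<-irrefl refl (ℚ.<-≤-trans (k n (ℕ.m≤n⊔m N M)) (subst (ε ℚ.≤_) (∣-∣-swap (seq y n) (seq x n))
    (subst (ℚ._≤ ℚ.∣ seq y n ℚ.- seq x n ∣) (ℚ.+-identityˡ ε) (p+ε≤q⇒ε≤∣q-p∣ (seq x n) (seq y n) ε (h n (ℕ.m≤m⊔n N M))))))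
  where n = N ℕ.⊔ M

x<x+ε : ∀ x {ε} → 0ℚ ℚ.< ε → x < x + fromℚ ε
x<x+ε x {ε} ε>0 = ε , ε>0 , 0 , λ n _ → ℚ.≤-refl

-- A negated inequality provides no index. Comparing x with the gap between y and y + ε does: one
-- alternative is excluded, and the other carries an explicit N.
≤⇒eventually : ∀ {x y} → x ≤ y → ∀ ε → 0ℚ ℚ.< ε → ∃[ N ] (∀ n → N ℕ.≤ n → seq x n ℚ.- seq y n ℚ.< ε)
≤⇒eventually {x} {y} x≤y ε ε>0 =
  [ (λ y<x → ⊥-elim (x≤y y<x)) , eventually ]′ (<-cotrans {y} {y + fromℚ ε} (x<x+ε y ε>0) x)
  where
  eventually : x < y + fromℚ ε → ∃[ N ] (∀ n → N ℕ.≤ n → seq x n ℚ.- seq y n ℚ.< ε)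
  eventually (η , η>0 , N , h) = N , λ n n≥ → ℚ.<-≤-trans
    (subst (ℚ._< seq x n ℚ.- seq y n ℚ.+ η) (ℚ.+-identityʳ _) (ℚ.+-monoʳ-< (seq x n ℚ.- seq y n) η>0))
    (≤-from-difference (0≤q-p (h n n≥))
      (ℚR.solve 4 (λ a b η ε → (b ℚR.:+ ε) ℚR.:- (a ℚR.:+ η) ℚR.:= ε ℚR.:- (a ℚR.:- b ℚR.:+ η)) refl
        (seq x n) (seq y n) η ε))

∣p∣<-from : ∀ {p ε} → p ℚ.< ε → ℚ.- p ℚ.< ε → ℚ.∣ p ∣ ℚ.< ε
∣p∣<-from {p} {ε} h k with ℚ.∣p∣≡p∨∣p∣≡-p p
... | inj₁ e = subst (ℚ._< ε) (sym e) h
... | inj₂ e = subst (ℚ._< ε) (sym e) k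

≤-antisym : ∀ {x y} → x ≤ y → y ≤ x → x ≈ y
≤-antisym {x} {y} x≤y y≤x ε ε>0 =
  let N , h = ≤⇒eventually {x} {y} x≤y ε ε>0
      M , k = ≤⇒eventually {y} {x} y≤x ε ε>0
  in N ℕ.⊔ M , λ n n≥ → ∣p∣<-from (h n (ℕ.m⊔n≤o⇒m≤o N M n≥))
      (subst (ℚ._< ε) (ℚR.solve 2 (λ a b → b ℚR.:- a ℚR.:= ℚR.:- (a ℚR.:- b)) refl (seq x n) (seq y n))
        (k n (ℕ.m⊔n≤o⇒n≤o N M n≥)))

-- The relations _≈_, _≤_ and _<_ unfold to statements about sequences, from
-- which the two reals cannot be inferred; these records can be inverted.

infix 4 _≃_ _⊑_ _⊏_

record _≃_ (x y : ℝ) : Set where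
  constructor ≈⇒≃
  field ≃⇒≈ : x ≈ y

record _⊑_ (x y : ℝ) : Set where
  constructor ≤⇒⊑
  field ⊑⇒≤ : x ≤ y

record _⊏_ (x y : ℝ) : Set where
  constructor <⇒⊏
  field ⊏⇒< : x < y

open _≃_ public
open _⊑_ public
open _⊏_ public

private module ℝ-Setoid = Setoid ℝ-setoid

≃-refl : ∀ {x} → x ≃ x
≃-refl {x} = ≈⇒≃ (ℝ-Setoid.refl {x})

≃-sym : ∀ {x y} → x ≃ y → y ≃ x
≃-sym {x} {y} (≈⇒≃ p) = ≈⇒≃ (ℝ-Setoid.sym {x} {y} p)

≃-trans : ∀ {x y z} → x ≃ y → y ≃ z → x ≃ z
≃-trans {x} {y} {z} (≈⇒≃ p) (≈⇒≃ q) = ≈⇒≃ (ℝ-Setoid.trans {x} {y} {z} p q)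

≃-pointwise : ∀ {x y} → (∀ n → seq x n ≡ seq y n) → x ≃ y
≃-pointwise {x} {y} h = ≈⇒≃ λ ε ε>0 → 0 , λ n _ →
  subst (ℚ._< ε) (sym (cong ℚ.∣_∣ (trans (cong (ℚ._- seq y n) (h n)) (ℚ.+-inverseʳ (seq y n))))) ε>0

+-cong : ∀ {x x′ y y′} → x ≃ x′ → y ≃ y′ → x + y ≃ x′ + y′
+-cong {x} {x′} {y} {y′} (≈⇒≃ p) (≈⇒≃ q) = ≈⇒≃ λ ε ε>0 →
  let N , h = p (½ ℚ.* ε) (half>0 ε>0)
      M , k = q (½ ℚ.* ε) (half>0 ε>0)
  in N ℕ.⊔ M , λ n n≥ → ℚ.≤-<-trans
       (subst (ℚ._≤ ℚ.∣ seq x n ℚ.- seq x′ n ∣ ℚ.+ ℚ.∣ seq y n ℚ.- seq y′ n ∣)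
         (cong ℚ.∣_∣ (ℚR.solve 4 (λ a b c d → (a ℚR.:- b) ℚR.:+ (c ℚR.:- d) ℚR.:= (a ℚR.:+ c) ℚR.:- (b ℚR.:+ d))
           refl (seq x n) (seq x′ n) (seq y n) (seq y′ n)))
         (ℚ.∣p+q∣≤∣p∣+∣q∣ (seq x n ℚ.- seq x′ n) (seq y n ℚ.- seq y′ n)))
       (subst (_ ℚ.<_) (halves ε)
         (ℚ.+-mono-< (h n (ℕ.m⊔n≤o⇒m≤o N M n≥)) (k n (ℕ.m⊔n≤o⇒n≤o N M n≥))))

*-cong : ∀ {x x′ y y′} → x ≃ x′ → y ≃ y′ → x * y ≃ x′ * y′
*-cong {x} {x′} {y} {y′} (≈⇒≃ p) (≈⇒≃ q) = ≈⇒≃ λ ε ε>0 →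
  let B , B>0 , N₁ , b  = eventually-bounded x
      C , C>0 , N₂ , c  = eventually-bounded y′
      k , k>0 , Bk≡1    = inv>0 B>0
      l , l>0 , Cl≡1    = inv>0 C>0
      N₃ , f            = p (½ ℚ.* ε ℚ.* l) (*>0 (half>0 ε>0) l>0)
      N₄ , g            = q (½ ℚ.* ε ℚ.* k) (*>0 (half>0 ε>0) k>0)
      N₁₂               = N₁ ℕ.⊔ N₂
      N₃₄               = N₃ ℕ.⊔ N₄
  in N₁₂ ℕ.⊔ N₃₄ , λ n n≥ →
    let n≥₁₂ = ℕ.m⊔n≤o⇒m≤o N₁₂ N₃₄ n≥
        n≥₃₄ = ℕ.m⊔n≤o⇒n≤o N₁₂ N₃₄ n≥
    in *-close {seq x n} {seq y n} {seq x′ n} {seq y′ n} {B} {C} {k} {l} {ε} B>0 C>0 Bk≡1 Cl≡1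
         (b n (ℕ.m⊔n≤o⇒m≤o N₁ N₂ n≥₁₂)) (c n (ℕ.m⊔n≤o⇒n≤o N₁ N₂ n≥₁₂))
         (g n (ℕ.m⊔n≤o⇒n≤o N₃ N₄ n≥₃₄)) (f n (ℕ.m⊔n≤o⇒m≤o N₃ N₄ n≥₃₄))

-‿cong : ∀ {x y} → x ≃ y → - x ≃ - y
-‿cong {x} {y} (≈⇒≃ p) = ≈⇒≃ λ ε ε>0 → let N , h = p ε ε>0 in N , λ n n≥ → subst (ℚ._< ε)
  (trans (∣-∣-swap (seq x n) (seq y n)) (cong ℚ.∣_∣
    (ℚR.solve 2 (λ a b → b ℚR.:- a ℚR.:= (ℚR.:- a) ℚR.:- (ℚR.:- b)) refl (seq x n) (seq y n))))
  (h n n≥)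

∣∣-cong : ∀ {x y} → x ≃ y → ∣ x ∣ ≃ ∣ y ∣
∣∣-cong {x} {y} (≈⇒≃ p) = ≈⇒≃ λ ε ε>0 → let N , h = p ε ε>0 in N , λ n n≥ →
  ℚ.≤-<-trans (∣∣p∣-∣q∣∣≤∣p-q∣ (seq x n) (seq y n)) (h n n≥)

⊏-cotrans : ∀ {x z} → x ⊏ z → ∀ y → x ⊏ y ⊎ y ⊏ z
⊏-cotrans {x} {z} (<⇒⊏ p) y = Sum.map <⇒⊏ <⇒⊏ (<-cotrans {x} {z} p y)

≃⇒⊑ : ∀ {x y} → x ≃ y → x ⊑ y
≃⇒⊑ {x} {y} p = ≤⇒⊑ (≈⇒≮ {y} {x} (≃⇒≈ (≃-sym p)))

⊑-refl : ∀ {x} → x ⊑ x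
⊑-refl = ≃⇒⊑ ≃-refl

⊏⇒⋣ : ∀ {x y} → x ⊏ y → ¬ (y ⊑ x)
⊏⇒⋣ (<⇒⊏ p) (≤⇒⊑ q) = q p

⊑-from-¬ : ∀ {x y} → ¬ (y ⊏ x) → x ⊑ y
⊑-from-¬ h = ≤⇒⊑ λ p → h (<⇒⊏ p)

⊑-stable : ∀ {x y} → ¬ ¬ (x ⊑ y) → x ⊑ y
⊑-stable h = ⊑-from-¬ λ y<x → h (⊏⇒⋣ y<x)

⊑-trans : ∀ {x y z} → x ⊑ y → y ⊑ z → x ⊑ z
⊑-trans {y = y} p q = ⊑-from-¬ λ z<x →
  [ (λ z<y → ⊏⇒⋣ z<y q) , (λ y<x → ⊏⇒⋣ y<x p) ]′ (⊏-cotrans z<x y)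

⊏-⊑-trans : ∀ {x y z} → x ⊏ y → y ⊑ z → x ⊏ z
⊏-⊑-trans {z = z} p q = [ id , (λ z<y → ⊥-elim (⊏⇒⋣ z<y q)) ]′ (⊏-cotrans p z)

⊑-⊏-trans : ∀ {x y z} → x ⊑ y → y ⊏ z → x ⊏ z
⊑-⊏-trans {x = x} p q = [ (λ y<x → ⊥-elim (⊏⇒⋣ y<x p)) , id ]′ (⊏-cotrans q x)

⊏⇒⊑ : ∀ {x y} → x ⊏ y → x ⊑ y
⊏⇒⊑ {x} {y} p = ⊑-from-¬ λ q → ⊏⇒⋣ (⊏-trans′ p q) ⊑-refl
  where
  ⊏-trans′ : ∀ {x y z} → x ⊏ y → y ⊏ z → x ⊏ z
  ⊏-trans′ {x} {y} {z} (<⇒⊏ (ε , ε>0 , N , h)) (<⇒⊏ (η , η>0 , M , k)) =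
    <⇒⊏ (ε , ε>0 , N ℕ.⊔ M , λ n n≥ → ℚ.≤-trans (h n (ℕ.m⊔n≤o⇒m≤o N M n≥))
      (≤-from-difference (0≤+ (0≤q-p (k n (ℕ.m⊔n≤o⇒n≤o N M n≥))) (ℚ.<⇒≤ η>0))
        (ℚR.solve 3 (λ a b η → b ℚR.:- (a ℚR.:+ η) ℚR.:+ η ℚR.:= b ℚR.:- a) refl (seq y n) (seq z n) η)))

⊏-trans : ∀ {x y z} → x ⊏ y → y ⊏ z → x ⊏ z
⊏-trans p q = ⊏-⊑-trans p (⊏⇒⊑ q)

⊑-antisym : ∀ {x y} → x ⊑ y → y ⊑ x → x ≃ y
⊑-antisym {x} {y} (≤⇒⊑ p) (≤⇒⊑ q) = ≈⇒≃ (≤-antisym {x} {y} p q)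

⊑-isPreorder : IsPreorder _≃_ _⊑_
⊑-isPreorder = record
  { isEquivalence = record { refl = ≃-refl ; sym = ≃-sym ; trans = ≃-trans }
  ; reflexive = ≃⇒⊑
  ; trans = ⊑-trans
  }

module ⊑-Reasoning where
  open import Relation.Binary.Reasoning.Base.Triple ⊑-isPreorder
    (λ p q → ⊏⇒⋣ p (⊏⇒⊑ q)) ⊏-trans
    ((λ p q → ⊏-⊑-trans q (≃⇒⊑ p)) , (λ p q → ⊑-⊏-trans (≃⇒⊑ (≃-sym p)) q))
    ⊏⇒⊑ ⊏-⊑-trans ⊑-⊏-trans public

⊑-pointwise : ∀ {x y} → (∀ n → seq x n ℚ.≤ seq y n) → x ⊑ y
⊑-pointwise {x} {y} h = ≤⇒⊑ λ where
  (ε , ε>0 , N , k) → ℚ.<-irrefl refl (ℚ.<-≤-trans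
    (subst (ℚ._< seq y N ℚ.+ ε) (ℚ.+-identityʳ _) (ℚ.+-monoʳ-< (seq y N) ε>0))
    (ℚ.≤-trans (k N ℕ.≤-refl) (h N)))

⊑-dichotomy : ∀ x y → ¬ ¬ (x ⊑ y ⊎ y ⊑ x)
⊑-dichotomy x y h = h (inj₁ (⊑-from-¬ λ p → h (inj₂ (⊏⇒⊑ p))))

-- The order and the ring operations

+-monoʳ-⊑ : ∀ z {x y} → x ⊑ y → z + x ⊑ z + y
+-monoʳ-⊑ z {x} {y} p = ≤⇒⊑ λ where
  (ε , ε>0 , N , k) → ⊑⇒≤ p (ε , ε>0 , N , λ n n≥ → ≤-from-difference (0≤q-p (k n n≥))
    (ℚR.solve 4 (λ a b c ε → (c ℚR.:+ a) ℚR.:- (c ℚR.:+ b ℚR.:+ ε) ℚR.:= a ℚR.:- (b ℚR.:+ ε)) refl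
      (seq x n) (seq y n) (seq z n) ε))

+-monoʳ-⊏ : ∀ z {x y} → x ⊏ y → z + x ⊏ z + y
+-monoʳ-⊏ z {x} {y} (<⇒⊏ (ε , ε>0 , N , k)) = <⇒⊏ (ε , ε>0 , N , λ n n≥ →
  ≤-from-difference (0≤q-p (k n n≥))
    (ℚR.solve 4 (λ a b c ε → b ℚR.:- (a ℚR.:+ ε) ℚR.:= (c ℚR.:+ b) ℚR.:- (c ℚR.:+ a ℚR.:+ ε)) refl
      (seq x n) (seq y n) (seq z n) ε))

+-comm : ∀ x y → x + y ≃ y + x
+-comm x y = ≃-pointwise λ n → ℚ.+-comm (seq x n) (seq y n)

*-comm : ∀ x y → x * y ≃ y * x
*-comm x y = ≃-pointwise λ n → ℚ.*-comm (seq x n) (seq y n)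

+-identityʳ : ∀ x → x + 0ℝ ≃ x
+-identityʳ x = ≃-pointwise λ n → ℚ.+-identityʳ (seq x n)

*-identityˡ : ∀ x → 1ℝ * x ≃ x
*-identityˡ x = ≃-pointwise λ n → ℚ.*-identityˡ (seq x n)

*-zeroʳ : ∀ x → x * 0ℝ ≃ 0ℝ
*-zeroʳ x = ≃-pointwise λ n → ℚ.*-zeroʳ (seq x n)

*-assoc : ∀ x y z → x * y * z ≃ x * (y * z)
*-assoc x y z = ≃-pointwise λ n → ℚ.*-assoc (seq x n) (seq y n) (seq z n)

+-mono-⊑ : ∀ {x y u v} → x ⊑ y → u ⊑ v → x + u ⊑ y + v
+-mono-⊑ {x} {y} {u} {v} p q = begin
  x + u ≤⟨ +-monoʳ-⊑ x q ⟩
  x + v ≈⟨ +-comm x v ⟩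
  v + x ≤⟨ +-monoʳ-⊑ v p ⟩
  v + y ≈⟨ +-comm v y ⟩
  y + v ∎
  where open ⊑-Reasoning

0⊑y-x : ∀ {x y} → x ⊑ y → 0ℝ ⊑ y - x
0⊑y-x {x} {y} p = begin
  0ℝ      ≈⟨ ≃-pointwise (λ n → sym (ℚ.+-inverseˡ (seq x n))) ⟩
  - x + x ≤⟨ +-monoʳ-⊑ (- x) p ⟩
  - x + y ≈⟨ +-comm (- x) y ⟩
  y - x   ∎
  where open ⊑-Reasoning

0⊏y-x : ∀ {x y} → x ⊏ y → 0ℝ ⊏ y - x
0⊏y-x {x} {y} p = begin-strict
  0ℝ      ≈⟨ ≃-pointwise (λ n → sym (ℚ.+-inverseˡ (seq x n))) ⟩
  - x + x <⟨ +-monoʳ-⊏ (- x) p ⟩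
  - x + y ≈⟨ +-comm (- x) y ⟩
  y - x   ∎
  where open ⊑-Reasoning

⊑-from-difference : ∀ {x y} → 0ℝ ⊑ y - x → x ⊑ y
⊑-from-difference {x} {y} p = begin
  x           ≈⟨ +-identityʳ x ⟨
  x + 0ℝ      ≤⟨ +-monoʳ-⊑ x p ⟩
  x + (y - x) ≈⟨ ≃-pointwise (λ n → ℚR.solve 2 (λ a b → a ℚR.:+ (b ℚR.:- a) ℚR.:= b) refl (seq x n) (seq y n)) ⟩
  y           ∎
  where open ⊑-Reasoning

⊏-from-difference : ∀ {x y} → 0ℝ ⊏ y - x → x ⊏ y
⊏-from-difference {x} {y} p = begin-strict
  x           ≈⟨ +-identityʳ x ⟨
  x + 0ℝ      <⟨ +-monoʳ-⊏ x p ⟩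
  x + (y - x) ≈⟨ ≃-pointwise (λ n → ℚR.solve 2 (λ a b → a ℚR.:+ (b ℚR.:- a) ℚR.:= b) refl (seq x n) (seq y n)) ⟩
  y           ∎
  where open ⊑-Reasoning

0⊑∣x∣ : ∀ x → 0ℝ ⊑ ∣ x ∣
0⊑∣x∣ x = ⊑-pointwise λ n → ℚ.0≤∣p∣ (seq x n)

x⊑∣x∣ : ∀ x → x ⊑ ∣ x ∣
x⊑∣x∣ x = ⊑-pointwise λ n → p≤∣p∣ (seq x n)

∣x*y∣≃∣x∣*∣y∣ : ∀ x y → ∣ x * y ∣ ≃ ∣ x ∣ * ∣ y ∣
∣x*y∣≃∣x∣*∣y∣ x y = ≃-pointwise λ n → ℚ.∣p*q∣≡∣p∣*∣q∣ (seq x n) (seq y n)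

∣x+y∣⊑∣x∣+∣y∣ : ∀ x y → ∣ x + y ∣ ⊑ ∣ x ∣ + ∣ y ∣
∣x+y∣⊑∣x∣+∣y∣ x y = ⊑-pointwise λ n → ℚ.∣p+q∣≤∣p∣+∣q∣ (seq x n) (seq y n)

∣-x∣≃∣x∣ : ∀ x → ∣ - x ∣ ≃ ∣ x ∣
∣-x∣≃∣x∣ x = ≃-pointwise λ n → ℚ.∣-p∣≡∣p∣ (seq x n)

∣x-y∣⊑∣x∣+∣y∣ : ∀ x y → ∣ x - y ∣ ⊑ ∣ x ∣ + ∣ y ∣
∣x-y∣⊑∣x∣+∣y∣ x y = ⊑-trans (∣x+y∣⊑∣x∣+∣y∣ x (- y)) (+-monoʳ-⊑ ∣ x ∣ (≃⇒⊑ (∣-x∣≃∣x∣ y)))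

-- The terms of a nonnegative real may be negative. If |x| exceeded x by ε from some index on, then
-- |x| = -x at those terms, hence x ≤ -ε/2 there, contrary to 0 ≤ x.
0⊑x⇒∣x∣≃x : ∀ {x} → 0ℝ ⊑ x → ∣ x ∣ ≃ x
0⊑x⇒∣x∣≃x {x} p = ⊑-antisym (≤⇒⊑ λ where
    (ε , ε>0 , N , h) → ⊑⇒≤ p (½ ℚ.* ε , half>0 ε>0 , N , λ n n≥ → negative (seq x n) ε>0 (h n n≥)))
  (x⊑∣x∣ x)
  where
  negative : ∀ p {ε} → 0ℚ ℚ.< ε → p ℚ.+ ε ℚ.≤ ℚ.∣ p ∣ → p ℚ.+ ½ ℚ.* ε ℚ.≤ 0ℚ
  negative p {ε} ε>0 h with ℚ.∣p∣≡p∨∣p∣≡-p p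
  ... | inj₁ e = ⊥-elim (ℚ.<-irrefl refl (ℚ.<-≤-trans
        (subst (ℚ._< p ℚ.+ ε) (ℚ.+-identityʳ p) (ℚ.+-monoʳ-< p ε>0)) (subst (p ℚ.+ ε ℚ.≤_) e h)))
  ... | inj₂ e = ≤-from-difference (0≤* (ℚ.nonNegative⁻¹ ½) (0≤q-p (subst (p ℚ.+ ε ℚ.≤_) e h)))
        (ℚR.solve 2 (λ p ε → ℚR.con ½ ℚR.:* (ℚR.:- p ℚR.:- (p ℚR.:+ ε)) ℚR.:= ℚR.con 0ℚ ℚR.:- (p ℚR.:+ ℚR.con ½ ℚR.:* ε)) refl p ε)

-- A termwise argument fails, since single terms of either factor may be negative. Absolute values
-- are nonnegative termwise and multiplicative, so the product is exchanged for |x y|.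
0⊑* : ∀ {x y} → 0ℝ ⊑ x → 0ℝ ⊑ y → 0ℝ ⊑ x * y
0⊑* {x} {y} p q = begin
  0ℝ            ≤⟨ 0⊑∣x∣ (x * y) ⟩
  ∣ x * y ∣     ≈⟨ ∣x*y∣≃∣x∣*∣y∣ x y ⟩
  ∣ x ∣ * ∣ y ∣ ≈⟨ *-cong (0⊑x⇒∣x∣≃x p) (0⊑x⇒∣x∣≃x q) ⟩
  x * y         ∎
  where open ⊑-Reasoning

0⊏* : ∀ {x y} → 0ℝ ⊏ x → 0ℝ ⊏ y → 0ℝ ⊏ x * y
0⊏* {x} {y} (<⇒⊏ (ε , ε>0 , N , h)) (<⇒⊏ (η , η>0 , M , k)) =
  <⇒⊏ (ε ℚ.* η , *>0 ε>0 η>0 , N ℕ.⊔ M , λ n n≥ →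
    let ε≤ = subst (ℚ._≤ seq x n) (ℚ.+-identityˡ ε) (h n (ℕ.m⊔n≤o⇒m≤o N M n≥))
        η≤ = subst (ℚ._≤ seq y n) (ℚ.+-identityˡ η) (k n (ℕ.m⊔n≤o⇒n≤o N M n≥))
    in subst (ℚ._≤ seq x n ℚ.* seq y n) (sym (ℚ.+-identityˡ (ε ℚ.* η)))
         (*-mono-≤-nonNeg {ε} {seq x n} {η} {seq y n} (ℚ.<⇒≤ η>0) (ℚ.≤-trans (ℚ.<⇒≤ ε>0) ε≤) ε≤ η≤))

*-monoˡ-⊑ : ∀ {z x y} → 0ℝ ⊑ z → x ⊑ y → z * x ⊑ z * y
*-monoˡ-⊑ {z} {x} {y} p q = ⊑-from-difference (begin
  0ℝ            ≤⟨ 0⊑* p (0⊑y-x q) ⟩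
  z * (y - x)   ≈⟨ ≃-pointwise (λ n → ℚR.solve 3 (λ x y z → z ℚR.:* (y ℚR.:- x) ℚR.:= z ℚR.:* y ℚR.:- z ℚR.:* x) refl
                     (seq x n) (seq y n) (seq z n)) ⟩
  z * y - z * x ∎)
  where open ⊑-Reasoning

*-monoˡ-⊏ : ∀ {z x y} → 0ℝ ⊏ z → x ⊏ y → z * x ⊏ z * y
*-monoˡ-⊏ {z} {x} {y} p q = ⊏-from-difference (begin-strict
  0ℝ            <⟨ 0⊏* p (0⊏y-x q) ⟩
  z * (y - x)   ≈⟨ ≃-pointwise (λ n → ℚR.solve 3 (λ x y z → z ℚR.:* (y ℚR.:- x) ℚR.:= z ℚR.:* y ℚR.:- z ℚR.:* x) refl
                     (seq x n) (seq y n) (seq z n)) ⟩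
  z * y - z * x ∎)
  where open ⊑-Reasoning

*-monoʳ-⊑ : ∀ {z x y} → 0ℝ ⊑ z → x ⊑ y → x * z ⊑ y * z
*-monoʳ-⊑ {z} {x} {y} p q = begin
  x * z ≈⟨ *-comm x z ⟩
  z * x ≤⟨ *-monoˡ-⊑ p q ⟩
  z * y ≈⟨ *-comm z y ⟩
  y * z ∎
  where open ⊑-Reasoning

*-mono-⊑ : ∀ {x y u v} → 0ℝ ⊑ x → 0ℝ ⊑ u → x ⊑ y → u ⊑ v → x * u ⊑ y * v
*-mono-⊑ 0⊑x 0⊑u p q = ⊑-trans (*-monoʳ-⊑ 0⊑u p) (*-monoˡ-⊑ (⊑-trans 0⊑x p) q)

0⊑+ : ∀ {x y} → 0ℝ ⊑ x → 0ℝ ⊑ y → 0ℝ ⊑ x + y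
0⊑+ {x} {y} p q = ⊑-trans (≃⇒⊑ (≃-sym (+-identityʳ 0ℝ))) (+-mono-⊑ p q)

0⊏1 : 0ℝ ⊏ 1ℝ
0⊏1 = <⇒⊏ (1ℚ , ℚ.positive⁻¹ 1ℚ , 0 , λ _ _ → ℚ.≤-refl)

0⊑1 : 0ℝ ⊑ 1ℝ
0⊑1 = ⊏⇒⊑ 0⊏1

x⊑x+y : ∀ x {y} → 0ℝ ⊑ y → x ⊑ x + y
x⊑x+y x {y} p = ⊑-trans (≃⇒⊑ (≃-sym (+-identityʳ x))) (+-monoʳ-⊑ x p)

x⊑y+x : ∀ x {y} → 0ℝ ⊑ y → x ⊑ y + x
x⊑y+x x {y} p = ⊑-trans (x⊑x+y x p) (≃⇒⊑ (+-comm x y))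

∣x∣⊑-from : ∀ {x b} → x ⊑ b → - x ⊑ b → ∣ x ∣ ⊑ b
∣x∣⊑-from {x} {b} p q = ⊑-stable λ h → ⊑-dichotomy 0ℝ x λ s → h (bound s)
  where
  open ⊑-Reasoning
  bound : 0ℝ ⊑ x ⊎ x ⊑ 0ℝ → ∣ x ∣ ⊑ b
  bound (inj₁ 0⊑x) = ⊑-trans (≃⇒⊑ (0⊑x⇒∣x∣≃x 0⊑x)) p
  bound (inj₂ x⊑0) = begin
    ∣ x ∣   ≈⟨ ∣-x∣≃∣x∣ x ⟨
    ∣ - x ∣ ≈⟨ 0⊑x⇒∣x∣≃x (⊑-trans (0⊑y-x x⊑0) (≃⇒⊑ (≃-pointwise λ n → ℚ.+-identityˡ (ℚ.- seq x n)))) ⟩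
    - x     ≤⟨ q ⟩
    b       ∎

0⊏^ : ∀ {x} k → 0ℝ ⊏ x → 0ℝ ⊏ x ^ k
0⊏^ zero    p = 0⊏1
0⊏^ (suc k) p = 0⊏* p (0⊏^ k p)

0⊑^ : ∀ {x} k → 0ℝ ⊑ x → 0ℝ ⊑ x ^ k
0⊑^ zero    p = 0⊑1
0⊑^ (suc k) p = 0⊑* p (0⊑^ k p)

^-mono-⊑ : ∀ {x y} k → 0ℝ ⊑ x → x ⊑ y → x ^ k ⊑ y ^ k
^-mono-⊑ zero    0⊑x p = ⊑-refl
^-mono-⊑ (suc k) 0⊑x p = *-mono-⊑ 0⊑x (0⊑^ k 0⊑x) p (^-mono-⊑ k 0⊑x p)

*-^-distrib : ∀ x y k → (x * y) ^ k ≃ x ^ k * y ^ k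
*-^-distrib x y zero    = ≃-sym (*-identityˡ 1ℝ)
*-^-distrib x y (suc k) = ≃-trans (*-cong ≃-refl (*-^-distrib x y k))
  (≃-pointwise λ n → ℚR.solve 4 (λ x y u v → x ℚR.:* y ℚR.:* (u ℚR.:* v) ℚR.:= x ℚR.:* u ℚR.:* (y ℚR.:* v)) refl
    (seq x n) (seq y n) (seq (x ^ k) n) (seq (y ^ k) n))

-- Reciprocals and the embeddings of ℤ and ℕ

recip-inverseʳ : ∀ x (x>0 : 0ℝ < x) → x * recip x x>0 ≃ 1ℝ
recip-inverseʳ x (δ , δ>0 , N , h) = ≈⇒≃ λ ε ε>0 → N , λ n n≥ →
  subst (ℚ._< ε) (cong ℚ.∣_∣ (sym (trans (cong (ℚ._- 1ℚ) (inverse n n≥)) (ℚ.+-inverseʳ 1ℚ)))) ε>0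
  where
  inverse : ∀ n → N ℕ.≤ n → seq x n ℚ.* recipℚ (seq x n) ≡ 1ℚ
  inverse n n≥ = recipℚ-inverse (ℚ.<-≤-trans δ>0 (subst (ℚ._≤ seq x n) (ℚ.+-identityˡ δ) (h n n≥)))

-- An eventual upper bound B of x gives the eventual lower bound 1/B of its reciprocal, which is the
-- gap that positivity asks for.
0⊏recip : ∀ x (x>0 : 0ℝ < x) → 0ℝ ⊏ recip x x>0
0⊏recip x x>0@(δ , δ>0 , N , h) =
  let B , B>0 , M , b = eventually-bounded x
      k , k>0 , Bk≡1  = inv>0 B>0
  in <⇒⊏ (k , k>0 , N ℕ.⊔ M , λ n n≥ →
       let a   = seq x n
           u   = recipℚ a
           a>0 = ℚ.<-≤-trans δ>0 (subst (ℚ._≤ a) (ℚ.+-identityˡ δ) (h n (ℕ.m⊔n≤o⇒m≤o N M n≥)))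
           au≡1 = recipℚ-inverse a>0
           a≤B = ℚ.≤-trans (p≤∣p∣ a) (b n (ℕ.m⊔n≤o⇒n≤o N M n≥))
       in subst (ℚ._≤ u) (sym (ℚ.+-identityˡ k)) (bound k u a B k>0 (recipℚ-nonneg a>0) a≤B au≡1 Bk≡1))
  where
  recipℚ-nonneg : ∀ {q} → 0ℚ ℚ.< q → 0ℚ ℚ.≤ recipℚ q
  recipℚ-nonneg {q} q>0 with q ℚ.≟ 0ℚ
  ... | yes _   = ℚ.≤-refl
  ... | no  q≢0 = ℚ.<⇒≤ (ℚ.positive⁻¹ _ {{ℚ.1/pos⇒pos q {{ℚ.positive q>0}}}})
  bound : ∀ k u a B → 0ℚ ℚ.< k → 0ℚ ℚ.≤ u → a ℚ.≤ B → a ℚ.* u ≡ 1ℚ → B ℚ.* k ≡ 1ℚ → k ℚ.≤ u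
  bound k u a B k>0 0≤u a≤B au≡1 Bk≡1 = subst₂ ℚ._≤_
    (cancel-inverse a u k au≡1)
    (trans (cong (B ℚ.*_) (ℚ.*-comm k u)) (cancel-inverse B k u Bk≡1))
    (ℚ.*-monoʳ-≤-nonNeg (k ℚ.* u) {{ℚ.nonNegative (0≤* (ℚ.<⇒≤ k>0) 0≤u)}} a≤B)

fromℤ-homo-- : ∀ a b → fromℤ (a ℤ.- b) ≃ fromℤ a - fromℤ b
fromℤ-homo-- a b = ≃-pointwise λ _ → trans (/1-homo-+ a (ℤ.- b)) (cong (a ℚ./ 1 ℚ.+_) (/1-homo-neg b))

fromℕ-homo-+ : ∀ a b → fromℕ (a ℕ.+ b) ≃ fromℕ a + fromℕ b
fromℕ-homo-+ a b = ≃-pointwise λ _ → /1-homo-+ (ℤ.+ a) (ℤ.+ b)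

fromℕ-homo-* : ∀ a b → fromℕ (a ℕ.* b) ≃ fromℕ a * fromℕ b
fromℕ-homo-* a b = ≃-pointwise λ _ →
  trans (cong (ℚ._/ 1) (ℤ.pos-* a b)) (/1-homo-* (ℤ.+ a) (ℤ.+ b))

fromℕ-∣∣ : ∀ a → fromℕ ℤ.∣ a ∣ ≃ ∣ fromℤ a ∣
fromℕ-∣∣ a = ≃-pointwise λ _ → /1-homo-∣∣ a

0⊑fromℕ : ∀ k → 0ℝ ⊑ fromℕ k
0⊑fromℕ k = ⊑-pointwise λ _ → 0≤k/1 k

fromℕ-mono : ∀ {a b} → a ℕ.≤ b → fromℕ a ⊑ fromℕ b
fromℕ-mono {a} {b} a≤b = begin
  fromℕ a                   ≤⟨ x⊑x+y (fromℕ a) (0⊑fromℕ (b ℕ.∸ a)) ⟩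
  fromℕ a + fromℕ (b ℕ.∸ a) ≈⟨ fromℕ-homo-+ a (b ℕ.∸ a) ⟨
  fromℕ (a ℕ.+ (b ℕ.∸ a))   ≡⟨ cong fromℕ (ℕ.m+[n∸m]≡n a≤b) ⟩
  fromℕ b                   ∎
  where open ⊑-Reasoning

∣i∣≡n⇒i≡±n : ∀ i {n} → ℤ.∣ i ∣ ≡ n → i ≡ ℤ.+ n ⊎ i ≡ ℤ.- (ℤ.+ n)
∣i∣≡n⇒i≡±n (ℤ.+ n)    refl = inj₁ refl
∣i∣≡n⇒i≡±n ℤ.-[1+ n ] refl = inj₂ refl

-- Counting

-- Restricting a count to a fibre of some map is expressed by adding "equal image" to `R`, so
-- neither subsets nor a decidable equality are involved.
Bounded : {A : Set} → Rel A 0ℓ → ℝ → Set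
Bounded R B = ∀ ys → AllPairs R ys → fromℕ (length ys) ⊑ B

0⊑bound : ∀ {A : Set} {R : Rel A 0ℓ} {B} → Bounded R B → 0ℝ ⊑ B
0⊑bound bounded = bounded [] []

module _ {A : Set} where

  AllPairs-resp-⊆ : ∀ {R : Rel A 0ℓ} {xs ys} → xs ⊆ ys → AllPairs R ys → AllPairs R xs
  AllPairs-resp-⊆ []         []       = []
  AllPairs-resp-⊆ (y ∷ʳ τ)   (_ ∷ ps) = AllPairs-resp-⊆ τ ps
  AllPairs-resp-⊆ (refl ∷ τ) (p ∷ ps) = All-resp-⊆ τ p ∷ AllPairs-resp-⊆ τ ps

  AllPairs-zip-All : ∀ {R T : Rel A 0ℓ} {P : Pred A 0ℓ} → (∀ {x y} → P x → P y → T x y) →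
                     ∀ {ys} → AllPairs R ys → All P ys → AllPairs (λ x y → R x y × T x y) ys
  AllPairs-zip-All f []       []         = []
  AllPairs-zip-All f (r ∷ rs) (p ∷ ps) =
    All.zipWith (λ (Rxy , Py) → Rxy , f p Py) (r , ps) ∷ AllPairs-zip-All f rs ps

  -- `P` need not be decidable. The head `y` is first placed among the elements outside `P`; any
  -- later proof of `P y` is refuted by going back and placing it inside.
  ¬¬-partition : ∀ (P : Pred A 0ℓ) ys → ¬ ¬ (∃[ us ] ∃[ vs ]
    (us ⊆ ys × All P us × vs ⊆ ys × All (∁ P) vs × length ys ≡ length us ℕ.+ length vs))
  ¬¬-partition P []       h = h ([] , [] , [] , [] , [] , [] , refl)
  ¬¬-partition P (y ∷ ys) h = ¬¬-partition P ys λ (us , vs , us⊆ , pu , vs⊆ , pv , len) →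
    h (us , y ∷ vs , y ∷ʳ us⊆ , pu , refl ∷ vs⊆
      , (λ py → h (y ∷ us , vs , refl ∷ us⊆ , py ∷ pu , y ∷ʳ vs⊆ , pv , cong suc len)) ∷ pv
      , trans (cong suc len) (sym (ℕ.+-suc (length us) (length vs))))

  length-partition : ∀ (P : Pred A 0ℓ) ys {B C} →
    (∀ us → us ⊆ ys → All P us → fromℕ (length us) ⊑ B) →
    (∀ vs → vs ⊆ ys → All (∁ P) vs → fromℕ (length vs) ⊑ C) →
    fromℕ (length ys) ⊑ B + C
  length-partition P ys {B} {C} inside outside = ⊑-stable λ h →
    ¬¬-partition P ys λ (us , vs , us⊆ , pu , vs⊆ , pv , len) → h (begin
      fromℕ (length ys)                     ≡⟨ cong fromℕ len ⟩
      fromℕ (length us ℕ.+ length vs)       ≈⟨ fromℕ-homo-+ (length us) (length vs) ⟩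
      fromℕ (length us) + fromℕ (length vs) ≤⟨ +-mono-⊑ (inside us us⊆ pu) (outside vs vs⊆ pv) ⟩
      B + C                                 ∎)
    where open ⊑-Reasoning

  -- There are 2K + 1 integers of absolute value at most K. Each induction step removes the two
  -- extreme levels, K + 1 and -(K + 1), at a cost of `B` each.
  length-by-levels : ∀ {R : Rel A 0ℓ} (z : A → ℤ) {B} → Bounded (λ x y → R x y × z x ≡ z y) B →
    ∀ K ys → AllPairs R ys → All (λ y → ℤ.∣ z y ∣ ℕ.≤ K) ys →
    fromℕ (length ys) ⊑ (fromℕ K + fromℕ K + 1ℝ) * B
  length-by-levels {R} z {B} bounded = go
    where
    open ⊑-Reasoning
    level : ∀ k ys → AllPairs R ys → All (λ y → z y ≡ k) ys → fromℕ (length ys) ⊑ B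
    level k ys rs eqs = bounded ys (AllPairs-zip-All (λ p q → trans p (sym q)) rs eqs)

    go : ∀ K ys → AllPairs R ys → All (λ y → ℤ.∣ z y ∣ ℕ.≤ K) ys →
         fromℕ (length ys) ⊑ (fromℕ K + fromℕ K + 1ℝ) * B
    go zero ys rs small = begin
      fromℕ (length ys)      ≤⟨ level ℤ.0ℤ ys rs (All.map (λ {y} p → ℤ.∣i∣≡0⇒i≡0 {z y} (ℕ.n≤0⇒n≡0 p)) small) ⟩
      B                      ≈⟨ ≃-pointwise (λ n → ℚ.*-identityˡ (seq B n)) ⟨
      (0ℝ + 0ℝ + 1ℝ) * B     ∎
    go (suc K) ys rs small = begin
      fromℕ (length ys)
        ≤⟨ length-partition (λ y → z y ≡ ℤ.+ suc K) ys
             (λ us us⊆ → level (ℤ.+ suc K) us (AllPairs-resp-⊆ us⊆ rs))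
             (λ vs vs⊆ ≢+ → length-partition (λ y → z y ≡ ℤ.-[1+ K ]) vs
               (λ us us⊆ → level ℤ.-[1+ K ] us (AllPairs-resp-⊆ (⊆-trans us⊆ vs⊆) rs))
               (λ ws ws⊆ ≢- → go K ws (AllPairs-resp-⊆ (⊆-trans ws⊆ vs⊆) rs)
                 (All.zipWith smaller
                   (All-resp-⊆ (⊆-trans ws⊆ vs⊆) small , All.zip (All-resp-⊆ ws⊆ ≢+ , ≢-))))) ⟩
      B + (B + (fromℕ K + fromℕ K + 1ℝ) * B)
        ≈⟨ ≃-pointwise (λ n → ℚR.solve 2 (λ b k →
             b ℚR.:+ (b ℚR.:+ (k ℚR.:+ k ℚR.:+ ℚR.con 1ℚ) ℚR.:* b) ℚR.:=
             ((ℚR.con 1ℚ ℚR.:+ k) ℚR.:+ (ℚR.con 1ℚ ℚR.:+ k) ℚR.:+ ℚR.con 1ℚ) ℚR.:* b) refl (seq B n) (ℤ.+ K ℚ./ 1)) ⟩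
      ((1ℝ + fromℕ K) + (1ℝ + fromℕ K) + 1ℝ) * B
        ≈⟨ *-cong (+-cong (+-cong (fromℕ-homo-+ 1 K) (fromℕ-homo-+ 1 K)) ≃-refl) ≃-refl ⟨
      (fromℕ (suc K) + fromℕ (suc K) + 1ℝ) * B ∎
      where
      smaller : ∀ {y} → ℤ.∣ z y ∣ ℕ.≤ suc K × ¬ (z y ≡ ℤ.+ suc K) × ¬ (z y ≡ ℤ.-[1+ K ]) → ℤ.∣ z y ∣ ℕ.≤ K
      smaller {y} (le , ≢+ , ≢-) = ℕ.≤-pred (ℕ.≤∧≢⇒< le λ eq → [ ≢+ , ≢- ]′ (∣i∣≡n⇒i≡±n (z y) eq))

  -- The floor of the real `D` cannot be computed. The maximum of the finitely many values that
  -- occur is a natural number that serves in its place.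
  common-bound : ∀ (f : A → ℕ) {D} → 0ℝ ⊑ D → ∀ {ys} → All (λ y → fromℕ (f y) ⊑ D) ys →
                 ∃[ K ] (fromℕ K ⊑ D × All (λ y → f y ℕ.≤ K) ys)
  common-bound f 0⊑D [] = 0 , 0⊑D , []
  common-bound f {D} 0⊑D {y ∷ ys} (p ∷ ps) =
    let K , K⊑D , qs = common-bound f 0⊑D ps
    in f y ℕ.⊔ K
     , [ (λ e → subst (λ k → fromℕ k ⊑ D) (sym e) p) , (λ e → subst (λ k → fromℕ k ⊑ D) (sym e) K⊑D) ]′ (ℕ.⊔-sel (f y) K)
     , ℕ.m≤m⊔n (f y) K ∷ All.map (λ q → ℕ.≤-trans q (ℕ.m≤n⊔m (f y) K)) qs

  -- The key of the first element is taken as origin: all keys then lie within `D` of it, and at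
  -- most 2D + 1 integers do. Shifting by a fixed key does not change which elements share a key.
  Bounded-by-key : ∀ {R : Rel A 0ℓ} (key : A → ℤ) {D B} → 0ℝ ⊑ D →
    (∀ x y → R x y → ∣ fromℤ (key x) - fromℤ (key y) ∣ ⊑ D) →
    Bounded (λ x y → R x y × key x ≡ key y) B → Bounded R ((D + D + 1ℝ) * B)
  Bounded-by-key key {D} {B} 0⊑D close bounded [] [] =
    0⊑* (0⊑+ (0⊑+ 0⊑D 0⊑D) 0⊑1) (0⊑bound bounded)
  Bounded-by-key {R} key {D} {B} 0⊑D close bounded (x ∷ ys) rs@(r ∷ _) =
    let K , K⊑D , small = common-bound (λ y → ℤ.∣ z y ∣) 0⊑D (at-head ∷ All.map at-tail r)
    in begin
      fromℕ (length (x ∷ ys))          ≤⟨ length-by-levels z same-level K (x ∷ ys) rs small ⟩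
      (fromℕ K + fromℕ K + 1ℝ) * B     ≤⟨ *-monoʳ-⊑ (0⊑bound bounded) (+-mono-⊑ (+-mono-⊑ K⊑D K⊑D) ⊑-refl) ⟩
      (D + D + 1ℝ) * B                 ∎
    where
    open ⊑-Reasoning
    z : A → ℤ
    z y = key x ℤ.- key y

    at-head : fromℕ ℤ.∣ z x ∣ ⊑ D
    at-head = subst (λ i → fromℕ ℤ.∣ i ∣ ⊑ D) (sym (ℤ.+-inverseʳ (key x))) 0⊑D

    at-tail : ∀ {y} → R x y → fromℕ ℤ.∣ z y ∣ ⊑ D
    at-tail {y} Rxy = begin
      fromℕ ℤ.∣ z y ∣                      ≈⟨ fromℕ-∣∣ (z y) ⟩
      ∣ fromℤ (z y) ∣                      ≈⟨ ∣∣-cong (fromℤ-homo-- (key x) (key y)) ⟩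
      ∣ fromℤ (key x) - fromℤ (key y) ∣    ≤⟨ close x y Rxy ⟩
      D                                    ∎

    same-level : Bounded (λ u v → R u v × z u ≡ z v) B
    same-level us ps = bounded us (AllPairs.map (λ {u} {v} (Ruv , eq) →
      Ruv , ℤ.neg-injective (∙-cancelˡ (key x) (ℤ.- key u) (ℤ.- key v) eq)) ps)

-- Polynomial functions

∣x∣⊑0⇒x≃0 : ∀ {x} → ∣ x ∣ ⊑ 0ℝ → x ≃ 0ℝ
∣x∣⊑0⇒x≃0 {x} p = ⊑-antisym (⊑-trans (x⊑∣x∣ x) p) (⊑-from-difference (begin
  0ℝ          ≤⟨ 0⊑y-x (⊑-trans (x⊑∣x∣ (- x)) (⊑-trans (≃⇒⊑ (∣-x∣≃∣x∣ x)) p)) ⟩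
  0ℝ - - x    ≈⟨ ≃-pointwise (λ n → ℚR.solve 1 (λ a → ℚR.con 0ℚ ℚR.:- ℚR.:- a ℚR.:= a ℚR.:- ℚR.con 0ℚ) refl (seq x n)) ⟩
  x - 0ℝ      ∎))
  where open ⊑-Reasoning

x*y≃0⇒y≃0 : ∀ {x y} → ¬ (x ≃ 0ℝ) → x * y ≃ 0ℝ → y ≃ 0ℝ
x*y≃0⇒y≃0 {x} {y} x≄0 xy≃0 = ∣x∣⊑0⇒x≃0 (⊑-from-¬ λ 0<∣y∣ → x≄0 (∣x∣⊑0⇒x≃0 (⊑-from-¬ λ 0<∣x∣ →
  ⊏⇒⋣ (0⊏* 0<∣x∣ 0<∣y∣) (begin
    ∣ x ∣ * ∣ y ∣ ≈⟨ ∣x*y∣≃∣x∣*∣y∣ x y ⟨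
    ∣ x * y ∣     ≈⟨ ∣∣-cong xy≃0 ⟩
    ∣ 0ℝ ∣        ≈⟨ 0⊑x⇒∣x∣≃x ⊑-refl ⟩
    0ℝ            ∎))))
  where open ⊑-Reasoning

-- "f is a polynomial function of degree at most n in which tⁿ has coefficient c",
-- by iterated divided differences.
HasDegree : ℕ → ℝ → (ℝ → ℝ) → Set
HasDegree zero    c f = ∀ x → f x ≃ c
HasDegree (suc n) c f = ∀ r → ∃[ g ] (HasDegree n c g × (∀ x → f x - f r ≃ (x - r) * g x))

HasDegree-cong : ∀ n {c c′ f} → c ≃ c′ → HasDegree n c f → HasDegree n c′ f
HasDegree-cong zero    e h x = ≃-trans (h x) e
HasDegree-cong (suc n) e h r = let g , hg , eq = h r in g , HasDegree-cong n e hg , eq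

HasDegree-+-* : ∀ n {c c′ f g} s → HasDegree n c f → HasDegree n c′ g →
                HasDegree n (c + s * c′) (λ x → f x + s * g x)
HasDegree-+-* zero    s hf hg x = +-cong (hf x) (*-cong ≃-refl (hg x))
HasDegree-+-* (suc n) {f = f} {g} s hf hg r =
  let u , hu , eu = hf r
      v , hv , ev = hg r
  in (λ x → u x + s * v x) , HasDegree-+-* n s hu hv , λ x → begin-equality
    (f x + s * g x) - (f r + s * g r)
      ≈⟨ ≃-pointwise (λ n → ℚR.solve 5 (λ s a b c d →
           (a ℚR.:+ s ℚR.:* c) ℚR.:- (b ℚR.:+ s ℚR.:* d) ℚR.:= (a ℚR.:- b) ℚR.:+ s ℚR.:* (c ℚR.:- d)) refl
           (seq s n) (seq (f x) n) (seq (f r) n) (seq (g x) n) (seq (g r) n)) ⟩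
    (f x - f r) + s * (g x - g r)
      ≈⟨ +-cong (eu x) (*-cong ≃-refl (ev x)) ⟩
    (x - r) * u x + s * ((x - r) * v x)
      ≈⟨ ≃-pointwise (λ n → ℚR.solve 4 (λ s y a b →
           y ℚR.:* a ℚR.:+ s ℚR.:* (y ℚR.:* b) ℚR.:= y ℚR.:* (a ℚR.:+ s ℚR.:* b)) refl
           (seq s n) (seq (x - r) n) (seq (u x) n) (seq (v x) n)) ⟩
    (x - r) * (u x + s * v x) ∎
  where open ⊑-Reasoning

HasDegree-suc : ∀ n {c f} → HasDegree n c f → HasDegree (suc n) 0ℝ f
HasDegree-suc zero {c} {f} h r = (λ _ → 0ℝ) , (λ _ → ≃-refl) , λ x → begin-equality
    f x - f r ≈⟨ +-cong (h x) (-‿cong (h r)) ⟩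
    c - c     ≈⟨ ≃-pointwise (λ n → ℚ.+-inverseʳ (seq c n)) ⟩
    0ℝ        ≈⟨ *-zeroʳ (x - r) ⟨
    (x - r) * 0ℝ ∎
  where open ⊑-Reasoning
HasDegree-suc (suc n) h r = let g , hg , eq = h r in g , HasDegree-suc n hg , eq

-- One Horner step. The divided difference of x f(x) at r is f(x) + r g(x), with g that of f.
-- Viewing f as having degree n + 1 with coefficient 0 there makes g of degree n with coefficient 0,
-- so the sum keeps the coefficient c.
HasDegree-a+x* : ∀ n {c f} a → HasDegree n c f → HasDegree (suc n) c (λ x → a + x * f x)
HasDegree-a+x* n {c} {f} a h r =
  let g , hg , eq = HasDegree-suc n h r
  in (λ x → f x + r * g x)
   , HasDegree-cong n (≃-trans (+-cong ≃-refl (*-zeroʳ r)) (+-identityʳ c)) (HasDegree-+-* n r h hg)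
   , λ x → begin-equality
    (a + x * f x) - (a + r * f r)
      ≈⟨ ≃-pointwise (λ n → ℚR.solve 5 (λ a x r u v →
           (a ℚR.:+ x ℚR.:* u) ℚR.:- (a ℚR.:+ r ℚR.:* v) ℚR.:= (x ℚR.:- r) ℚR.:* u ℚR.:+ r ℚR.:* (u ℚR.:- v)) refl
           (seq a n) (seq x n) (seq r n) (seq (f x) n) (seq (f r) n)) ⟩
    (x - r) * f x + r * (f x - f r)
      ≈⟨ +-cong ≃-refl (*-cong ≃-refl (eq x)) ⟩
    (x - r) * f x + r * ((x - r) * g x)
      ≈⟨ ≃-pointwise (λ n → ℚR.solve 4 (λ s y a b →
           y ℚR.:* a ℚR.:+ s ℚR.:* (y ℚR.:* b) ℚR.:= y ℚR.:* (a ℚR.:+ s ℚR.:* b)) refl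
           (seq r n) (seq (x - r) n) (seq (f x) n) (seq (g x) n)) ⟩
    (x - r) * (f x + r * g x) ∎
  where open ⊑-Reasoning

-- Induction on the degree. Entries whose value equals the root r of the head contribute at most
-- `B`. Any other root annihilates the divided difference at r, which has degree one less and the
-- same leading coefficient; in degree 0 a nonzero constant has no root at all.
length-by-roots : ∀ {A : Set} {R : Rel A 0ℓ} (κ : A → ℝ) {B} →
  Bounded (λ x y → R x y × κ x ≃ κ y) B → ∀ n {c f} → ¬ (c ≃ 0ℝ) → HasDegree n c f →
  ∀ ys → AllPairs R ys → All (λ y → f (κ y) ≃ 0ℝ) ys → fromℕ (length ys) ⊑ fromℕ n * B
length-by-roots κ bounded n c≄0 h [] rs roots = 0⊑* (0⊑fromℕ n) (0⊑bound bounded)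
length-by-roots κ bounded zero c≄0 h (y ∷ ys) rs (root ∷ _) = ⊥-elim (c≄0 (≃-trans (≃-sym (h (κ y))) root))
length-by-roots κ {B} bounded (suc n) {c} {f} c≄0 h (y ∷ ys) rs roots@(root ∷ _) =
  let g , hg , eq = h r
      root-of-g : ∀ {x} → f (κ x) ≃ 0ℝ × ¬ (κ x ≃ r) → g (κ x) ≃ 0ℝ
      root-of-g {x} (fx≃0 , x≄r) = x*y≃0⇒y≃0 (λ x-r≃0 → x≄r (x-y≃0⇒x≃y x-r≃0)) (begin-equality
        (κ x - r) * g (κ x) ≈⟨ eq (κ x) ⟨
        f (κ x) - f r       ≈⟨ +-cong fx≃0 (-‿cong root) ⟩
        0ℝ - 0ℝ             ≈⟨ ≃-pointwise (λ _ → refl) ⟩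
        0ℝ                  ∎)
  in begin
    fromℕ (length (y ∷ ys))
      ≤⟨ length-partition (λ x → κ x ≃ r) (y ∷ ys)
           (λ us us⊆ eqs → bounded us (AllPairs-zip-All (λ p q → ≃-trans p (≃-sym q)) (AllPairs-resp-⊆ us⊆ rs) eqs))
           (λ vs vs⊆ neqs → length-by-roots κ bounded n c≄0 hg vs (AllPairs-resp-⊆ vs⊆ rs)
             (All.zipWith root-of-g (All-resp-⊆ vs⊆ roots , neqs))) ⟩
    B + fromℕ n * B
      ≈⟨ ≃-pointwise (λ k → ℚR.solve 2 (λ b m → b ℚR.:+ m ℚR.:* b ℚR.:= (ℚR.con 1ℚ ℚR.:+ m) ℚR.:* b) refl (seq B k) (ℤ.+ n ℚ./ 1)) ⟩
    (1ℝ + fromℕ n) * B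
      ≈⟨ *-cong (fromℕ-homo-+ 1 n) ≃-refl ⟨
    fromℕ (suc n) * B ∎
  where
  open ⊑-Reasoning
  r = κ y
  x-y≃0⇒x≃y : ∀ {x y} → x - y ≃ 0ℝ → x ≃ y
  x-y≃0⇒x≃y {x} {y} p = begin-equality
    x           ≈⟨ ≃-pointwise (λ n → ℚR.solve 2 (λ a b → a ℚR.:= (a ℚR.:- b) ℚR.:+ b) refl (seq x n) (seq y n)) ⟩
    (x - y) + y ≈⟨ +-cong p ≃-refl ⟩
    0ℝ + y      ≈⟨ ≃-pointwise (λ n → ℚ.+-identityˡ (seq y n)) ⟩
    y           ∎

-- Evaluation of coefficient lists

eval-zero : ∀ P x → (∀ i → coeffℤ P i ≡ ℤ.0ℤ) → eval P x ≃ 0ℝ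
eval-zero []      x zeros = ≃-refl
eval-zero (a ∷ P) x zeros = begin-equality
  fromℤ a + x * eval P x ≡⟨ cong (λ b → fromℤ b + x * eval P x) (zeros 0) ⟩
  0ℝ + x * eval P x      ≈⟨ +-cong ≃-refl (*-cong ≃-refl (eval-zero P x (λ i → zeros (suc i)))) ⟩
  0ℝ + x * 0ℝ            ≈⟨ +-cong ≃-refl (*-zeroʳ x) ⟩
  0ℝ + 0ℝ                ≈⟨ +-identityʳ 0ℝ ⟩
  0ℝ                     ∎
  where open ⊑-Reasoning

eval-constant : ∀ a P x → (∀ i → coeffℤ P i ≡ ℤ.0ℤ) → eval (a ∷ P) x ≃ fromℤ a
eval-constant a P x zeros = begin-equality
  fromℤ a + x * eval P x ≈⟨ +-cong ≃-refl (*-cong ≃-refl (eval-zero P x zeros)) ⟩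
  fromℤ a + x * 0ℝ       ≈⟨ +-cong ≃-refl (*-zeroʳ x) ⟩
  fromℤ a + 0ℝ           ≈⟨ +-identityʳ (fromℤ a) ⟩
  fromℤ a                ∎
  where open ⊑-Reasoning

coeffℤ-drop : ∀ P i → coeffℤ (drop 1 P) i ≡ coeffℤ P (suc i)
coeffℤ-drop []      i = refl
coeffℤ-drop (a ∷ P) i = refl

eval-uncons : ∀ P x → eval P x ≃ fromℤ (coeffℤ P 0) + x * eval (drop 1 P) x
eval-uncons []      x = ≃-sym (≃-trans (+-cong ≃-refl (*-zeroʳ x)) (+-identityʳ 0ℝ))
eval-uncons (a ∷ P) x = ≃-refl

-- Equal polynomials may be lists with different numbers of trailing zeros, hence the comparison by
-- coefficients.
eval-cong : ∀ P P′ x → (∀ i → coeffℤ P i ≡ coeffℤ P′ i) → eval P x ≃ eval P′ x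
eval-cong []      P′ x eq = ≃-sym (eval-zero P′ x (λ i → sym (eq i)))
eval-cong (a ∷ P) P′ x eq = begin-equality
  fromℤ a + x * eval P x                          ≡⟨ cong (λ b → fromℤ b + x * eval P x) (eq 0) ⟩
  fromℤ (coeffℤ P′ 0) + x * eval P x              ≈⟨ +-cong ≃-refl (*-cong ≃-refl (eval-cong P (drop 1 P′) x
                                                       (λ i → trans (eq (suc i)) (sym (coeffℤ-drop P′ i))))) ⟩
  fromℤ (coeffℤ P′ 0) + x * eval (drop 1 P′) x    ≈⟨ eval-uncons P′ x ⟨
  eval P′ x                                       ∎
  where open ⊑-Reasoning

eval-difference-suc : ∀ P P′ x → eval P x - eval P′ x ≃
  (fromℤ (coeffℤ P 0) - fromℤ (coeffℤ P′ 0)) + x * (eval (drop 1 P) x - eval (drop 1 P′) x)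
eval-difference-suc P P′ x = ≃-trans (+-cong (eval-uncons P x) (-‿cong (eval-uncons P′ x)))
  (≃-pointwise λ n → ℚR.solve 5 (λ a b x u v → (a ℚR.:+ x ℚR.:* u) ℚR.:- (b ℚR.:+ x ℚR.:* v) ℚR.:=
    (a ℚR.:- b) ℚR.:+ x ℚR.:* (u ℚR.:- v)) refl
    (coeffℤ P 0 ℚ./ 1) (coeffℤ P′ 0 ℚ./ 1) (seq x n) (seq (eval (drop 1 P) x) n) (seq (eval (drop 1 P′) x) n))

eval-difference₁ : ∀ P P′ x → (∀ i → 1 ℕ.≤ i → coeffℤ P i ≡ coeffℤ P′ i) →
  eval P x - eval P′ x ≃ fromℤ (coeffℤ P 0) - fromℤ (coeffℤ P′ 0)
eval-difference₁ P P′ x eq = begin-equality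
  eval P x - eval P′ x ≈⟨ eval-difference-suc P P′ x ⟩
  a + x * (eval T x - eval T′ x)
    ≈⟨ +-cong ≃-refl (*-cong ≃-refl (+-cong (eval-cong T T′ x
         (λ i → trans (coeffℤ-drop P i) (trans (eq (suc i) (ℕ.s≤s ℕ.z≤n)) (sym (coeffℤ-drop P′ i))))) ≃-refl)) ⟩
  a + x * (eval T′ x - eval T′ x)
    ≈⟨ ≃-pointwise (λ n → ℚR.solve 3 (λ a x u → a ℚR.:+ x ℚR.:* (u ℚR.:- u) ℚR.:= a) refl
         (seq a n) (seq x n) (seq (eval T′ x) n)) ⟩
  a ∎
  where
  open ⊑-Reasoning
  T  = drop 1 P
  T′ = drop 1 P′
  a  = fromℤ (coeffℤ P 0) - fromℤ (coeffℤ P′ 0)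

eval-difference₂ : ∀ P P′ x → (∀ i → 2 ℕ.≤ i → coeffℤ P i ≡ coeffℤ P′ i) →
  eval P x - eval P′ x ≃ (fromℤ (coeffℤ P 0) - fromℤ (coeffℤ P′ 0)) +
                         x * (fromℤ (coeffℤ P 1) - fromℤ (coeffℤ P′ 1))
eval-difference₂ P P′ x eq = begin-equality
  eval P x - eval P′ x ≈⟨ eval-difference-suc P P′ x ⟩
  a + x * (eval T x - eval T′ x)
    ≈⟨ +-cong ≃-refl (*-cong ≃-refl (eval-difference₁ T T′ x
         (λ i 1≤i → trans (coeffℤ-drop P i) (trans (eq (suc i) (ℕ.s≤s 1≤i)) (sym (coeffℤ-drop P′ i)))))) ⟩
  a + x * (fromℤ (coeffℤ T 0) - fromℤ (coeffℤ T′ 0))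
    ≡⟨ cong₂ (λ u v → a + x * (fromℤ u - fromℤ v)) (coeffℤ-drop P 0) (coeffℤ-drop P′ 0) ⟩
  a + x * (fromℤ (coeffℤ P 1) - fromℤ (coeffℤ P′ 1)) ∎
  where
  open ⊑-Reasoning
  T  = drop 1 P
  T′ = drop 1 P′
  a  = fromℤ (coeffℤ P 0) - fromℤ (coeffℤ P′ 0)

eval-HasDegree : ∀ n P → (∀ i → n ℕ.< i → coeffℤ P i ≡ ℤ.0ℤ) → HasDegree n (fromℤ (coeffℤ P n)) (eval P)
eval-HasDegree n []      _ = zero-HasDegree n
  where
  zero-HasDegree : ∀ n → HasDegree n 0ℝ (λ _ → 0ℝ)
  zero-HasDegree zero    x = ≃-refl
  zero-HasDegree (suc n) = HasDegree-suc n (zero-HasDegree n)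
eval-HasDegree zero    (a ∷ P) deg x = eval-constant a P x (λ i → deg (suc i) (ℕ.s≤s ℕ.z≤n))
eval-HasDegree (suc n) (a ∷ P) deg =
  HasDegree-a+x* n (fromℤ a) (eval-HasDegree n P (λ i n<i → deg (suc i) (ℕ.s≤s n<i)))

-- Heights, geometric sums and growth estimates

∣coeffℤ∣≤height : ∀ P i → ℤ.∣ coeffℤ P i ∣ ℕ.≤ height P
∣coeffℤ∣≤height []      i       = ℕ.z≤n
∣coeffℤ∣≤height (a ∷ P) zero    = ℕ.m≤m⊔n ℤ.∣ a ∣ (height P)
∣coeffℤ∣≤height (a ∷ P) (suc i) = ℕ.≤-trans (∣coeffℤ∣≤height P i) (ℕ.m≤n⊔m ℤ.∣ a ∣ (height P))

-- The sum 1 + e + ... + eⁿ in Horner form. At e = |x| + 1 it is ρₙ(x), and it makes sense at x = 0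
-- without a case distinction.
geometric : ℕ → ℝ → ℝ
geometric zero    e = 1ℝ
geometric (suc n) e = 1ℝ + e * geometric n e

0⊑geometric : ∀ n {e} → 0ℝ ⊑ e → 0ℝ ⊑ geometric n e
0⊑geometric zero    0⊑e = 0⊑1
0⊑geometric (suc n) 0⊑e = 0⊑+ 0⊑1 (0⊑* 0⊑e (0⊑geometric n 0⊑e))

1⊑geometric : ∀ n {e} → 0ℝ ⊑ e → 1ℝ ⊑ geometric n e
1⊑geometric zero    0⊑e = ⊑-refl
1⊑geometric (suc n) 0⊑e = x⊑x+y 1ℝ (0⊑* 0⊑e (0⊑geometric n 0⊑e))

e*geometric⊑ : ∀ n e → e * geometric n e ⊑ geometric (suc n) e
e*geometric⊑ n e = x⊑y+x (e * geometric n e) 0⊑1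

geometric-closed : ∀ n x → x * geometric n (x + 1ℝ) ≃ (x + 1ℝ) ^ suc n - 1ℝ
geometric-closed zero x = ≃-pointwise λ n →
  ℚR.solve 1 (λ x → x ℚR.:* ℚR.con 1ℚ ℚR.:= (x ℚR.:+ ℚR.con 1ℚ) ℚR.:* ℚR.con 1ℚ ℚR.:- ℚR.con 1ℚ) refl (seq x n)
geometric-closed (suc n) x = begin-equality
  x * (1ℝ + e * geometric n e)
    ≈⟨ ≃-pointwise (λ k → ℚR.solve 3 (λ x e g → x ℚR.:* (ℚR.con 1ℚ ℚR.:+ e ℚR.:* g) ℚR.:= x ℚR.:+ e ℚR.:* (x ℚR.:* g)) refl
         (seq x k) (seq e k) (seq (geometric n e) k)) ⟩
  x + e * (x * geometric n e)
    ≈⟨ +-cong ≃-refl (*-cong ≃-refl (geometric-closed n x)) ⟩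
  x + e * (e ^ suc n - 1ℝ)
    ≈⟨ ≃-pointwise (λ k → ℚR.solve 2 (λ x p → x ℚR.:+ (x ℚR.:+ ℚR.con 1ℚ) ℚR.:* (p ℚR.:- ℚR.con 1ℚ) ℚR.:=
         (x ℚR.:+ ℚR.con 1ℚ) ℚR.:* p ℚR.:- ℚR.con 1ℚ) refl (seq x k) (seq (e ^ suc n) k)) ⟩
  e ^ suc (suc n) - 1ℝ ∎
  where
  open ⊑-Reasoning
  e = x + 1ℝ

geometric-one : ∀ n {e} → e ≃ 1ℝ → geometric n e ≃ fromℕ (suc n)
geometric-one zero    e≃1 = ≃-refl
geometric-one (suc n) {e} e≃1 = begin-equality
  1ℝ + e * geometric n e   ≈⟨ +-cong ≃-refl (*-cong e≃1 (geometric-one n e≃1)) ⟩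
  1ℝ + 1ℝ * fromℕ (suc n)  ≈⟨ +-cong ≃-refl (*-identityˡ (fromℕ (suc n))) ⟩
  1ℝ + fromℕ (suc n)       ≈⟨ fromℕ-homo-+ 1 (suc n) ⟨
  fromℕ (suc (suc n))      ∎
  where open ⊑-Reasoning

≃-stable : ∀ {x y} → ¬ ¬ (x ≃ y) → x ≃ y
≃-stable h = ⊑-antisym (⊑-stable λ k → h λ e → k (≃⇒⊑ e)) (⊑-stable λ k → h λ e → k (≃⇒⊑ (≃-sym e)))

-- It cannot be decided which clause applies, but the equality is stable under double negation. If
-- it failed, the clause away from zero would refute 0 < |x|, so x would be 0, and then the other
-- clause gives the equality.
IsRho⇒geometric : ∀ {n x r} → IsRho n x r → r ≃ geometric n (∣ x ∣ + 1ℝ)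
IsRho⇒geometric {n} {x} {r} rho = ≃-stable λ h → h (at-zero (∣x∣⊑0⇒x≃0 (⊑-from-¬ λ 0<∣x∣ → h (off-zero (⊏⇒< 0<∣x∣)))))
  where
  open ⊑-Reasoning
  e = ∣ x ∣ + 1ℝ
  off-zero : 0ℝ < ∣ x ∣ → r ≃ geometric n e
  off-zero ∣x∣>0 = begin-equality
    r                                    ≈⟨ ≈⇒≃ (IsRho.off-zero rho ∣x∣>0) ⟩
    (e ^ (n ℕ.+ 1) - 1ℝ) * u             ≡⟨ cong (λ k → (e ^ k - 1ℝ) * u) (ℕ.+-comm n 1) ⟩
    (e ^ suc n - 1ℝ) * u                 ≈⟨ *-cong (geometric-closed n ∣ x ∣) ≃-refl ⟨
    ∣ x ∣ * geometric n e * u            ≈⟨ ≃-pointwise (λ k → ℚR.solve 3 (λ x g u → x ℚR.:* g ℚR.:* u ℚR.:= x ℚR.:* u ℚR.:* g) refl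
                                              (seq ∣ x ∣ k) (seq (geometric n e) k) (seq u k)) ⟩
    ∣ x ∣ * u * geometric n e            ≈⟨ *-cong (recip-inverseʳ ∣ x ∣ ∣x∣>0) ≃-refl ⟩
    1ℝ * geometric n e                   ≈⟨ *-identityˡ (geometric n e) ⟩
    geometric n e                        ∎
    where u = recip ∣ x ∣ ∣x∣>0
  at-zero : x ≃ 0ℝ → r ≃ geometric n e
  at-zero x≃0 = begin-equality
    r                ≈⟨ ≈⇒≃ (IsRho.at-zero rho (≃⇒≈ x≃0)) ⟩
    fromℕ (n ℕ.+ 1)  ≡⟨ cong fromℕ (ℕ.+-comm n 1) ⟩
    fromℕ (suc n)    ≈⟨ geometric-one n (≃-trans (+-cong (≃-trans (∣∣-cong x≃0) (0⊑x⇒∣x∣≃x ⊑-refl)) ≃-refl)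
                          (≃-pointwise λ _ → refl)) ⟨
    geometric n e    ∎

eval-bound : ∀ n P {x e Q} → ∣ x ∣ ⊑ e → (∀ i → fromℕ ℤ.∣ coeffℤ P i ∣ ⊑ Q) →
  (∀ i → n ℕ.< i → coeffℤ P i ≡ ℤ.0ℤ) → ∣ eval P x ∣ ⊑ Q * geometric n e
eval-bound n [] {x} {e} {Q} ∣x∣⊑e small deg = begin
  ∣ 0ℝ ∣            ≈⟨ 0⊑x⇒∣x∣≃x ⊑-refl ⟩
  0ℝ                ≤⟨ 0⊑* (small 0) (0⊑geometric n (⊑-trans (0⊑∣x∣ x) ∣x∣⊑e)) ⟩
  Q * geometric n e ∎
  where open ⊑-Reasoning
eval-bound zero (a ∷ P) {x} {e} {Q} ∣x∣⊑e small deg = begin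
  ∣ eval (a ∷ P) x ∣ ≈⟨ ∣∣-cong (eval-constant a P x (λ i → deg (suc i) (ℕ.s≤s ℕ.z≤n))) ⟩
  ∣ fromℤ a ∣        ≈⟨ fromℕ-∣∣ a ⟨
  fromℕ ℤ.∣ a ∣      ≤⟨ small 0 ⟩
  Q                  ≈⟨ *-identityˡ Q ⟨
  1ℝ * Q             ≈⟨ *-comm 1ℝ Q ⟩
  Q * 1ℝ             ∎
  where open ⊑-Reasoning
eval-bound (suc n) (a ∷ P) {x} {e} {Q} ∣x∣⊑e small deg = begin
  ∣ fromℤ a + x * eval P x ∣       ≤⟨ ∣x+y∣⊑∣x∣+∣y∣ (fromℤ a) (x * eval P x) ⟩
  ∣ fromℤ a ∣ + ∣ x * eval P x ∣   ≈⟨ +-cong (≃-sym (fromℕ-∣∣ a)) (∣x*y∣≃∣x∣*∣y∣ x (eval P x)) ⟩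
  fromℕ ℤ.∣ a ∣ + ∣ x ∣ * ∣ eval P x ∣
    ≤⟨ +-mono-⊑ (small 0) (*-mono-⊑ (0⊑∣x∣ x) (0⊑∣x∣ (eval P x)) ∣x∣⊑e
         (eval-bound n P ∣x∣⊑e (λ i → small (suc i)) (λ i n<i → deg (suc i) (ℕ.s≤s n<i)))) ⟩
  Q + e * (Q * geometric n e)
    ≈⟨ ≃-pointwise (λ k → ℚR.solve 3 (λ q e g → q ℚR.:+ e ℚR.:* (q ℚR.:* g) ℚR.:= q ℚR.:* (ℚR.con 1ℚ ℚR.:+ e ℚR.:* g)) refl
         (seq Q k) (seq e k) (seq (geometric n e) k)) ⟩
  Q * geometric (suc n) e ∎
  where open ⊑-Reasoning

-- The factor |d| + 1, rather than a bound for the derivative near d, suffices because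
-- x P(x) − d P(d) = d (P(x) − P(d)) + (x − d) P(x).
eval-lipschitz : ∀ n P {x d Q} → ∣ x - d ∣ ⊑ 1ℝ → (∀ i → fromℕ ℤ.∣ coeffℤ P i ∣ ⊑ Q) →
  (∀ i → n ℕ.< i → coeffℤ P i ≡ ℤ.0ℤ) →
  ∣ eval P x - eval P d ∣ ⊑ ∣ x - d ∣ * (Q * geometric n (∣ d ∣ + 1ℝ))
eval-lipschitz n P {x} {d} {Q} near = go n P
  where
  open ⊑-Reasoning
  e = ∣ d ∣ + 1ℝ
  δ = ∣ x - d ∣
  0⊑e : 0ℝ ⊑ e
  0⊑e = 0⊑+ (0⊑∣x∣ d) 0⊑1
  ∣x∣⊑e : ∣ x ∣ ⊑ e
  ∣x∣⊑e = begin
    ∣ x ∣           ≈⟨ ∣∣-cong (≃-pointwise λ k → ℚR.solve 2 (λ x d → x ℚR.:= d ℚR.:+ (x ℚR.:- d)) refl (seq x k) (seq d k)) ⟩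
    ∣ d + (x - d) ∣ ≤⟨ ∣x+y∣⊑∣x∣+∣y∣ d (x - d) ⟩
    ∣ d ∣ + δ       ≤⟨ +-monoʳ-⊑ ∣ d ∣ near ⟩
    e               ∎

  trivial : ∀ n {u v} → 0ℝ ⊑ Q → u ≃ v → ∣ u - v ∣ ⊑ δ * (Q * geometric n e)
  trivial n {u} {v} 0⊑Q u≃v = begin
    ∣ u - v ∣ ≈⟨ ∣∣-cong (≃-trans (+-cong u≃v ≃-refl) (≃-pointwise λ k → ℚ.+-inverseʳ (seq v k))) ⟩
    ∣ 0ℝ ∣    ≈⟨ 0⊑x⇒∣x∣≃x ⊑-refl ⟩
    0ℝ        ≤⟨ 0⊑* (0⊑∣x∣ (x - d)) (0⊑* 0⊑Q (0⊑geometric n 0⊑e)) ⟩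
    δ * (Q * geometric n e) ∎

  go : ∀ n P → (∀ i → fromℕ ℤ.∣ coeffℤ P i ∣ ⊑ Q) → (∀ i → n ℕ.< i → coeffℤ P i ≡ ℤ.0ℤ) →
       ∣ eval P x - eval P d ∣ ⊑ δ * (Q * geometric n e)
  go n       []      small deg = trivial n (small 0) ≃-refl
  go zero    (a ∷ P) small deg = trivial zero (⊑-trans (0⊑fromℕ ℤ.∣ a ∣) (small 0))
    (≃-trans (eval-constant a P x zeros) (≃-sym (eval-constant a P d zeros)))
    where
    zeros : ∀ i → coeffℤ P i ≡ ℤ.0ℤ
    zeros i = deg (suc i) (ℕ.s≤s ℕ.z≤n)
  go (suc n) (a ∷ P) small deg = begin
    ∣ (fromℤ a + x * eval P x) - (fromℤ a + d * eval P d) ∣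
      ≈⟨ ∣∣-cong (≃-pointwise λ k → ℚR.solve 5 (λ a x d u v →
           (a ℚR.:+ x ℚR.:* u) ℚR.:- (a ℚR.:+ d ℚR.:* v) ℚR.:= d ℚR.:* (u ℚR.:- v) ℚR.:+ (x ℚR.:- d) ℚR.:* u) refl
           (a ℚ./ 1) (seq x k) (seq d k) (seq (eval P x) k) (seq (eval P d) k)) ⟩
    ∣ d * (eval P x - eval P d) + (x - d) * eval P x ∣
      ≤⟨ ∣x+y∣⊑∣x∣+∣y∣ (d * (eval P x - eval P d)) ((x - d) * eval P x) ⟩
    ∣ d * (eval P x - eval P d) ∣ + ∣ (x - d) * eval P x ∣
      ≈⟨ +-cong (∣x*y∣≃∣x∣*∣y∣ d (eval P x - eval P d)) (∣x*y∣≃∣x∣*∣y∣ (x - d) (eval P x)) ⟩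
    ∣ d ∣ * ∣ eval P x - eval P d ∣ + δ * ∣ eval P x ∣
      ≤⟨ +-mono-⊑ (*-monoˡ-⊑ (0⊑∣x∣ d) (go n P small′ deg′))
           (*-monoˡ-⊑ (0⊑∣x∣ (x - d)) (eval-bound n P ∣x∣⊑e small′ deg′)) ⟩
    ∣ d ∣ * (δ * (Q * g)) + δ * (Q * g)
      ≈⟨ ≃-pointwise (λ k → ℚR.solve 4 (λ d δ q g → d ℚR.:* (δ ℚR.:* (q ℚR.:* g)) ℚR.:+ δ ℚR.:* (q ℚR.:* g) ℚR.:=
           δ ℚR.:* (q ℚR.:* ((d ℚR.:+ ℚR.con 1ℚ) ℚR.:* g))) refl (seq ∣ d ∣ k) (seq δ k) (seq Q k) (seq g k)) ⟩
    δ * (Q * (e * g))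
      ≤⟨ *-monoˡ-⊑ (0⊑∣x∣ (x - d)) (*-monoˡ-⊑ (⊑-trans (0⊑fromℕ ℤ.∣ a ∣) (small 0)) (e*geometric⊑ n e)) ⟩
    δ * (Q * geometric (suc n) e) ∎
    where
    g = geometric n e
    small′ : ∀ i → fromℕ ℤ.∣ coeffℤ P i ∣ ⊑ Q
    small′ i = small (suc i)
    deg′ : ∀ i → n ℕ.< i → coeffℤ P i ≡ ℤ.0ℤ
    deg′ i n<i = deg (suc i) (ℕ.s≤s n<i)

-- Counting points through the coefficients of their polynomials

Bounded-map : ∀ {A : Set} {R T : Rel A 0ℓ} {B} → (∀ x y → R x y → T x y) → Bounded T B → Bounded R B
Bounded-map f bounded ys rs = bounded ys (AllPairs.map (λ {x} {y} → f x y) rs)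

Bounded-mono : ∀ {A : Set} {R : Rel A 0ℓ} {B C} → B ⊑ C → Bounded R B → Bounded R C
Bounded-mono B⊑C bounded ys rs = ⊑-trans (bounded ys rs) B⊑C

module Counting (n : ℕ) (Q d₁ d₂ δ₁ δ₂ : ℝ) (δ₁⊑1 : δ₁ ⊑ 1ℝ) (δ₂⊑1 : δ₂ ⊑ 1ℝ) where
  open ⊑-Reasoning

  record Point : Set where
    field
      α₁ α₂   : ℝ
      poly    : List ℤ
      leading : coeffℤ poly n ≡ ℤ.1ℤ
      degree  : ∀ i → n ℕ.< i → coeffℤ poly i ≡ ℤ.0ℤ
      small   : ∀ i → fromℕ ℤ.∣ coeffℤ poly i ∣ ⊑ Q
      root₁   : eval poly α₁ ≃ 0ℝ
      root₂   : eval poly α₂ ≃ 0ℝ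
      near₁   : ∣ α₁ - d₁ ∣ ⊑ δ₁
      near₂   : ∣ α₂ - d₂ ∣ ⊑ δ₂
  open Point

  Distinct : Rel Point 0ℓ
  Distinct p q = ¬ (α₁ p ≃ α₁ q × α₂ p ≃ α₂ q)

  -- These relations form the ladder of the count. Any two distinct points agree from n on;
  -- agreement from 0 on means a common polynomial; each rung in between frees one coefficient.
  AgreeFrom : ℕ → Rel Point 0ℓ
  AgreeFrom j p q = Distinct p q × (∀ i → j ℕ.≤ i → coeffℤ (poly p) i ≡ coeffℤ (poly q) i)

  -- All polynomials in the list have the coefficients of the first one, so every value of κ is a
  -- root of that single monic polynomial, whose leading coefficient 1 is not zero.
  Bounded-by-roots : ∀ {R : Rel Point 0ℓ} (κ : Point → ℝ) → (∀ p → eval (poly p) (κ p) ≃ 0ℝ) →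
    (∀ p q → R p q → ∀ i → coeffℤ (poly p) i ≡ coeffℤ (poly q) i) →
    ∀ {B} → Bounded (λ p q → R p q × κ p ≃ κ q) B → Bounded R (fromℕ n * B)
  Bounded-by-roots κ root same bounded [] [] = 0⊑* (0⊑fromℕ n) (0⊑bound bounded)
  Bounded-by-roots κ root same bounded (p ∷ ps) rs@(r ∷ _) =
    length-by-roots κ bounded n (λ c≃0 → ⊏⇒⋣ 0⊏1 (≃⇒⊑ (≃-trans (≃-sym leading≃1) c≃0)))
      (eval-HasDegree n (poly p) (degree p)) (p ∷ ps) rs
      (root p ∷ All.map (λ {q} Rpq → ≃-trans (eval-cong (poly p) (poly q) (κ q) (same p q Rpq)) (root q)) r)
    where
    leading≃1 : fromℤ (coeffℤ (poly p) n) ≃ 1ℝ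
    leading≃1 = ≃-pointwise λ _ → cong (ℚ._/ 1) (leading p)

  -- At most n choices for each coordinate, and one point for each choice of both. The trailing
  -- factor 1 is also what n ^ 2 unfolds to in `c₇`.
  N : ℝ
  N = fromℕ n * (fromℕ n * 1ℝ)

  AgreeFrom-0-bound : Bounded (AgreeFrom 0) N
  AgreeFrom-0-bound =
    Bounded-by-roots α₁ root₁ (λ p q (_ , same) i → same i ℕ.z≤n)
      (Bounded-by-roots α₂ root₂ (λ p q ((_ , same) , _) i → same i ℕ.z≤n) singleton)
    where
    singleton : Bounded (λ p q → (AgreeFrom 0 p q × α₁ p ≃ α₁ q) × α₂ p ≃ α₂ q) 1ℝ
    singleton []          _ = 0⊑1
    singleton (_ ∷ [])    _ = ⊑-refl
    singleton (_ ∷ _ ∷ _) (((((distinct , _) , eq₁) , eq₂) ∷ _) ∷ _) = ⊥-elim (distinct (eq₁ , eq₂))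

  Bounded-suc : ∀ j {D B} → 0ℝ ⊑ D →
    (∀ p q → AgreeFrom (suc j) p q → ∣ fromℤ (coeffℤ (poly p) j) - fromℤ (coeffℤ (poly q) j) ∣ ⊑ D) →
    Bounded (AgreeFrom j) B → Bounded (AgreeFrom (suc j)) ((D + D + 1ℝ) * B)
  Bounded-suc j 0⊑D close bounded = Bounded-by-key (λ p → coeffℤ (poly p) j) 0⊑D close
    (Bounded-map (λ p q ((distinct , same) , eq) → distinct , λ i j≤i →
      [ same i , (λ { refl → eq }) ]′ (ℕ.m≤n⇒m<n∨m≡n j≤i)) bounded)

  -- `E₁` bounds |P(d₁)| for a single polynomial and `L₁` the difference of two such values. For δ₁
  -- half the side length, `L₁` becomes μ₁(I₁) Q ρₙ(d₁).
  E₁ E₂ L₁ L₂ : ℝ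
  E₁ = δ₁ * (Q * geometric n (∣ d₁ ∣ + 1ℝ))
  E₂ = δ₂ * (Q * geometric n (∣ d₂ ∣ + 1ℝ))
  L₁ = E₁ + E₁
  L₂ = E₂ + E₂

  value-bound : ∀ p {α d δ} → δ ⊑ 1ℝ → eval (poly p) α ≃ 0ℝ → ∣ α - d ∣ ⊑ δ →
                ∣ eval (poly p) d ∣ ⊑ δ * (Q * geometric n (∣ d ∣ + 1ℝ))
  value-bound p {α} {d} {δ} δ⊑1 root near = begin
    ∣ eval P d ∣               ≈⟨ ∣-x∣≃∣x∣ (eval P d) ⟨
    ∣ - eval P d ∣             ≈⟨ ∣∣-cong (≃-pointwise λ k → ℚ.+-identityˡ (ℚ.- seq (eval P d) k)) ⟨
    ∣ 0ℝ - eval P d ∣          ≈⟨ ∣∣-cong (+-cong root ≃-refl) ⟨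
    ∣ eval P α - eval P d ∣    ≤⟨ eval-lipschitz n P (⊑-trans near δ⊑1) (small p) (degree p) ⟩
    ∣ α - d ∣ * (Q * g)        ≤⟨ *-monoʳ-⊑ (0⊑* 0⊑Q (0⊑geometric n (0⊑+ (0⊑∣x∣ d) 0⊑1))) near ⟩
    δ * (Q * g)                ∎
    where
    P = poly p
    g = geometric n (∣ d ∣ + 1ℝ)
    0⊑Q : 0ℝ ⊑ Q
    0⊑Q = ⊑-trans (0⊑fromℕ ℤ.∣ coeffℤ (poly p) 0 ∣) (small p 0)

  difference-bound : ∀ {x y E} → ∣ x ∣ ⊑ E → ∣ y ∣ ⊑ E → ∣ x - y ∣ ⊑ E + E
  difference-bound {x} {y} p q = ⊑-trans (∣x-y∣⊑∣x∣+∣y∣ x y) (+-mono-⊑ p q)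

  values-at-d₁ : ∀ p q → ∣ eval (poly p) d₁ - eval (poly q) d₁ ∣ ⊑ L₁
  values-at-d₁ p q = difference-bound (value-bound p δ₁⊑1 (root₁ p) (near₁ p)) (value-bound q δ₁⊑1 (root₁ q) (near₁ q))

  values-at-d₂ : ∀ p q → ∣ eval (poly p) d₂ - eval (poly q) d₂ ∣ ⊑ L₂
  values-at-d₂ p q = difference-bound (value-bound p δ₂⊑1 (root₂ p) (near₂ p)) (value-bound q δ₂⊑1 (root₂ q) (near₂ q))

  -- When only the constant coefficient is free, the difference of values is the same at every
  -- point. So `d` is left open, to be taken where the bound `L` is smaller.
  AgreeFrom-1-bound : ∀ {d L} → 0ℝ ⊑ L → (∀ p q → ∣ eval (poly p) d - eval (poly q) d ∣ ⊑ L) →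
             Bounded (AgreeFrom 1) ((L + L + 1ℝ) * N)
  AgreeFrom-1-bound {d} {L} 0⊑L values = Bounded-suc 0 0⊑L
    (λ p q (_ , same) → ⊑-trans (≃⇒⊑ (∣∣-cong (≃-sym (eval-difference₁ (poly p) (poly q) d same)))) (values p q))
    AgreeFrom-0-bound

  module _ (u : ℝ) (0⊑u : 0ℝ ⊑ u) (Δu≃1 : ∣ d₁ - d₂ ∣ * u ≃ 1ℝ) (0⊑L₁ : 0ℝ ⊑ L₁) (0⊑L₂ : 0ℝ ⊑ L₂) where

    D : ℝ
    D = (L₁ + L₂) * u

    -- Subtracting the values at d₁ and d₂ eliminates the constant coefficient.
    slopes : ∀ p q → AgreeFrom 2 p q → ∣ fromℤ (coeffℤ (poly p) 1) - fromℤ (coeffℤ (poly q) 1) ∣ ⊑ D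
    slopes p q (_ , same) = begin
      ∣ b ∣                        ≈⟨ *-identityˡ ∣ b ∣ ⟨
      1ℝ * ∣ b ∣                   ≈⟨ *-cong Δu≃1 ≃-refl ⟨
      Δ * u * ∣ b ∣                ≈⟨ ≃-pointwise (λ k → ℚR.solve 3 (λ Δ u b → Δ ℚR.:* u ℚR.:* b ℚR.:= (Δ ℚR.:* b) ℚR.:* u) refl
                                        (seq Δ k) (seq u k) (seq ∣ b ∣ k)) ⟩
      (Δ * ∣ b ∣) * u              ≈⟨ *-cong (∣x*y∣≃∣x∣*∣y∣ (d₁ - d₂) b) ≃-refl ⟨
      ∣ (d₁ - d₂) * b ∣ * u        ≈⟨ *-cong (∣∣-cong (≃-pointwise λ k → ℚR.solve 4 (λ x y a b →
                                        (x ℚR.:- y) ℚR.:* b ℚR.:= (a ℚR.:+ x ℚR.:* b) ℚR.:- (a ℚR.:+ y ℚR.:* b)) refl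
                                        (seq d₁ k) (seq d₂ k) (seq a k) (seq b k))) ≃-refl ⟩
      ∣ (a + d₁ * b) - (a + d₂ * b) ∣ * u
        ≤⟨ *-monoʳ-⊑ 0⊑u (∣x-y∣⊑∣x∣+∣y∣ (a + d₁ * b) (a + d₂ * b)) ⟩
      (∣ a + d₁ * b ∣ + ∣ a + d₂ * b ∣) * u
        ≈⟨ *-cong (+-cong (∣∣-cong (eval-difference₂ (poly p) (poly q) d₁ same))
             (∣∣-cong (eval-difference₂ (poly p) (poly q) d₂ same))) ≃-refl ⟨
      (∣ eval (poly p) d₁ - eval (poly q) d₁ ∣ + ∣ eval (poly p) d₂ - eval (poly q) d₂ ∣) * u
        ≤⟨ *-monoʳ-⊑ 0⊑u (+-mono-⊑ (values-at-d₁ p q) (values-at-d₂ p q)) ⟩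
      (L₁ + L₂) * u ∎
      where
      Δ = ∣ d₁ - d₂ ∣
      a = fromℤ (coeffℤ (poly p) 0) - fromℤ (coeffℤ (poly q) 0)
      b = fromℤ (coeffℤ (poly p) 1) - fromℤ (coeffℤ (poly q) 1)

    AgreeFrom-2-bound : ∀ {B} → Bounded (AgreeFrom 1) B → Bounded (AgreeFrom 2) ((D + D + 1ℝ) * B)
    AgreeFrom-2-bound = Bounded-suc 1 (0⊑* (0⊑+ 0⊑L₁ 0⊑L₂) 0⊑u) slopes

    -- Here `s` and `l` are the smaller and the larger of L₁ and L₂. As 1 = Δu ≤ l u, the linear
    -- coefficient takes at most 2D + 1 ≤ 5 l u values, and as 1 ≤ s, the constant one at most 2s +
    -- 1 ≤ 3s; hence 15.
    coefficient-pairs-bound : ∀ {s l} → s ⊑ l → 1ℝ ⊑ s → ∣ d₁ - d₂ ∣ ⊑ l → D ⊑ (l + l) * u →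
                 (D + D + 1ℝ) * ((s + s + 1ℝ) * N) ⊑ fromℕ 15 * (s * l * u) * N
    coefficient-pairs-bound {s} {l} s⊑l 1⊑s Δ⊑l D⊑ = begin
      (D + D + 1ℝ) * ((s + s + 1ℝ) * N)
        ≤⟨ *-mono-⊑ (0⊑+ (0⊑+ 0⊑D 0⊑D) 0⊑1) (0⊑* (0⊑+ (0⊑+ 0⊑s 0⊑s) 0⊑1) (0⊑bound AgreeFrom-0-bound))
             (+-mono-⊑ (+-mono-⊑ D⊑ D⊑) 1⊑lu)
             (*-monoʳ-⊑ (0⊑bound AgreeFrom-0-bound) (+-monoʳ-⊑ (s + s) 1⊑s)) ⟩
      ((l + l) * u + (l + l) * u + l * u) * ((s + s + s) * N)
        ≈⟨ ≃-pointwise (λ k → ℚR.solve 4 (λ s l u N →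
             ((l ℚR.:+ l) ℚR.:* u ℚR.:+ (l ℚR.:+ l) ℚR.:* u ℚR.:+ l ℚR.:* u) ℚR.:* ((s ℚR.:+ s ℚR.:+ s) ℚR.:* N) ℚR.:=
             ℚR.con (ℤ.+ 15 ℚ./ 1) ℚR.:* (s ℚR.:* l ℚR.:* u) ℚR.:* N) refl (seq s k) (seq l k) (seq u k) (seq N k)) ⟩
      fromℕ 15 * (s * l * u) * N ∎
      where
      0⊑D : 0ℝ ⊑ D
      0⊑D = 0⊑* (0⊑+ 0⊑L₁ 0⊑L₂) 0⊑u
      0⊑s : 0ℝ ⊑ s
      0⊑s = ⊑-trans 0⊑1 1⊑s
      1⊑lu : 1ℝ ⊑ l * u
      1⊑lu = ⊑-trans (≃⇒⊑ (≃-sym Δu≃1)) (*-monoʳ-⊑ 0⊑u Δ⊑l)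

    -- The larger of L₁ and L₂ governs the linear coefficient and the smaller the constant one, so
    -- either order produces the product L₁ L₂. Which is larger is undecidable, but stability of the
    -- conclusion allows the case distinction.
    AgreeFrom-2-area-bound : 1ℝ ⊑ L₁ → 1ℝ ⊑ L₂ → ∣ d₁ - d₂ ∣ ⊑ L₁ → ∣ d₁ - d₂ ∣ ⊑ L₂ →
                Bounded (AgreeFrom 2) (fromℕ 15 * (L₁ * L₂ * u) * N)
    AgreeFrom-2-area-bound 1⊑L₁ 1⊑L₂ Δ⊑L₁ Δ⊑L₂ ys rs = ⊑-stable λ h → ⊑-dichotomy L₁ L₂ λ where
      (inj₁ L₁⊑L₂) → h (⊑-trans (AgreeFrom-2-bound (AgreeFrom-1-bound 0⊑L₁ values-at-d₁) ys rs)
        (coefficient-pairs-bound L₁⊑L₂ 1⊑L₁ Δ⊑L₂ (*-monoʳ-⊑ 0⊑u (+-mono-⊑ L₁⊑L₂ ⊑-refl))))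
      (inj₂ L₂⊑L₁) → h (⊑-trans (⊑-trans (AgreeFrom-2-bound (AgreeFrom-1-bound 0⊑L₂ values-at-d₂) ys rs)
        (coefficient-pairs-bound L₂⊑L₁ 1⊑L₂ Δ⊑L₁ (*-monoʳ-⊑ 0⊑u (+-monoʳ-⊑ L₁ L₂⊑L₁))))
        (≃⇒⊑ (*-cong (*-cong ≃-refl (*-cong (*-comm L₂ L₁) ≃-refl)) ≃-refl)))

  -- Two coefficients of absolute value at most Q differ by at most 2Q, which allows 2 · 2Q + 1 ≤ 5Q
  -- integers. The weaker 8Q turns into the factor 2³ that `c₇` has for each degree.
  AgreeFrom-2+m-bound : 1ℝ ⊑ Q → ∀ {B} → Bounded (AgreeFrom 2) B → ∀ m → Bounded (AgreeFrom (2 ℕ.+ m)) ((fromℕ 8 * Q) ^ m * B)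
  AgreeFrom-2+m-bound 1⊑Q {B} bounded zero    = Bounded-mono (≃⇒⊑ (≃-sym (*-identityˡ B))) bounded
  AgreeFrom-2+m-bound 1⊑Q {B} bounded (suc m) = Bounded-mono (begin
      ((Q + Q) + (Q + Q) + 1ℝ) * ((fromℕ 8 * Q) ^ m * B)
        ≤⟨ *-monoʳ-⊑ (0⊑bound previous) 4Q+1⊑8Q ⟩
      fromℕ 8 * Q * ((fromℕ 8 * Q) ^ m * B)
        ≈⟨ *-assoc (fromℕ 8 * Q) ((fromℕ 8 * Q) ^ m) B ⟨
      (fromℕ 8 * Q) ^ suc m * B ∎)
    (Bounded-suc (2 ℕ.+ m) (0⊑+ 0⊑Q 0⊑Q) (λ p q _ → difference-bound (coefficient p) (coefficient q)) previous)
    where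
    previous = AgreeFrom-2+m-bound 1⊑Q bounded m
    0⊑Q : 0ℝ ⊑ Q
    0⊑Q = ⊑-trans 0⊑1 1⊑Q
    coefficient : ∀ p → ∣ fromℤ (coeffℤ (poly p) (2 ℕ.+ m)) ∣ ⊑ Q
    coefficient p = ⊑-trans (≃⇒⊑ (≃-sym (fromℕ-∣∣ (coeffℤ (poly p) (2 ℕ.+ m))))) (small p (2 ℕ.+ m))
    4Q+1⊑8Q : (Q + Q) + (Q + Q) + 1ℝ ⊑ fromℕ 8 * Q
    4Q+1⊑8Q = begin
      (Q + Q) + (Q + Q) + 1ℝ                    ≤⟨ +-monoʳ-⊑ _ 1⊑Q ⟩
      (Q + Q) + (Q + Q) + Q                     ≤⟨ x⊑x+y _ (0⊑+ (0⊑+ 0⊑Q 0⊑Q) 0⊑Q) ⟩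
      ((Q + Q) + (Q + Q) + Q) + (Q + Q + Q)     ≈⟨ ≃-pointwise (λ k → ℚR.solve 1 (λ q →
        ((q ℚR.:+ q) ℚR.:+ (q ℚR.:+ q) ℚR.:+ q) ℚR.:+ (q ℚR.:+ q ℚR.:+ q) ℚR.:= ℚR.con (ℤ.+ 8 ℚ./ 1) ℚR.:* q) refl (seq Q k)) ⟩
      fromℕ 8 * Q ∎

  -- Being monic fixes the coefficient of tⁿ, so the ladder starts at n and not at n + 1. This is
  -- why only n - 2 coefficients contribute a factor Q each.
  Distinct⇒AgreeFrom : ∀ p q → Distinct p q → AgreeFrom n p q
  Distinct⇒AgreeFrom p q distinct = distinct , λ i n≤i →
    [ (λ n<i → trans (degree p i n<i) (sym (degree q i n<i)))
    , (λ { refl → trans (leading p) (sym (leading q)) }) ]′ (ℕ.m≤n⇒m<n∨m≡n n≤i)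

-- Large Q: comparing real powers through rational exponents

archimedean : ∀ ε → 0ℚ ℚ.< ε → ∃[ p ] (ℤ.+ 1 ℚ./ suc p ℚ.< ε)
archimedean ε ε>0 = go ε (ℚ.positive ε>0)
  where
  go : ∀ ε → ℚ.Positive ε → ∃[ p ] (ℤ.+ 1 ℚ./ suc p ℚ.< ε)
  -- `b` is the denominator minus one, so ε ≥ 1/(b + 1) > 1/(b + 2), and the denominator b + 2
  -- belongs to the witness `suc b`.
  go ε@(ℚ.mkℚ (ℤ.+ suc a) b _) _ = suc b , ℚ.toℚᵘ-cancel-< (ℚᵘ.<-respˡ-≃
    (ℚᵘ.≃-sym (ℚ.toℚᵘ-fromℚᵘ (ℚᵘ.mkℚᵘ (ℤ.+ 1) (suc b))))
    (ℚᵘ.*<* (ℤ.+<+ (ℕ.<-≤-trans (ℕ.s≤s (ℕ.≤-reflexive (cong suc (ℕ.+-identityʳ b)))) (ℕ.m≤m+n (2 ℕ.+ b) _)))))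

p/q+1/q≡1 : ∀ p → ℤ.+ p ℚ./ suc p ℚ.+ ℤ.+ 1 ℚ./ suc p ≡ 1ℚ
p/q+1/q≡1 p = ℚ.toℚᵘ-injective (begin
  ℚ.toℚᵘ (ℤ.+ p ℚ./ suc p ℚ.+ ℤ.+ 1 ℚ./ suc p)
    ≈⟨ ℚ.toℚᵘ-homo-+ (ℤ.+ p ℚ./ suc p) (ℤ.+ 1 ℚ./ suc p) ⟩
  ℚ.toℚᵘ (ℤ.+ p ℚ./ suc p) ℚᵘ.+ ℚ.toℚᵘ (ℤ.+ 1 ℚ./ suc p)
    ≈⟨ ℚᵘ.+-cong (ℚ.toℚᵘ-fromℚᵘ (ℚᵘ.mkℚᵘ (ℤ.+ p) p)) (ℚ.toℚᵘ-fromℚᵘ (ℚᵘ.mkℚᵘ (ℤ.+ 1) p)) ⟩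
  ℚᵘ.mkℚᵘ (ℤ.+ p) p ℚᵘ.+ ℚᵘ.mkℚᵘ (ℤ.+ 1) p
    ≈⟨ ℚᵘ.*≡* numerators ⟩
  ℚᵘ.1ℚᵘ ∎)
  where
  open ℚᵘ.≃-Reasoning
  q = ℤ.+ suc p
  numerators : (ℤ.+ p ℤ.* q ℤ.+ ℤ.+ 1 ℤ.* q) ℤ.* ℤ.+ 1 ≡ ℤ.+ 1 ℤ.* (q ℤ.* q)
  numerators = trans (ℤ.*-identityʳ (ℤ.+ p ℤ.* q ℤ.+ ℤ.+ 1 ℤ.* q))
    (trans (sym (ℤ.*-distribʳ-+ q (ℤ.+ p) (ℤ.+ 1)))
    (trans (cong (λ k → ℤ.+ k ℤ.* q) (ℕ.+-comm p 1)) (sym (ℤ.*-identityˡ (q ℤ.* q)))))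

reciprocal-below : ∀ γ → 0ℝ < γ → ∃[ p ] (fromℚ (ℤ.+ 1 ℚ./ suc p) < γ)
reciprocal-below γ (ε , ε>0 , N , h) =
  let p , r<ε = archimedean ε ε>0
      r = ℤ.+ 1 ℚ./ suc p
  in p , ε ℚ.- r , subst (ℚ._< ε ℚ.- r) (ℚ.+-inverseʳ r) (ℚ.+-monoˡ-< (ℚ.- r) r<ε) , N , λ n n≥ →
     subst (ℚ._≤ seq γ n) (ℚR.solve 2 (λ ε r → ℚR.con 0ℚ ℚR.:+ ε ℚR.:= r ℚR.:+ (ε ℚR.:- r)) refl ε r) (h n n≥)

-- The form p/(p + 1) is chosen because then Q^(p+1) and Q^p differ by exactly one factor Q, which
-- `power-eventually-small` compares with M^(p+1).
fraction-above : ∀ γ → γ < 1ℝ → ∃[ p ] (γ < fromℚ (ℤ.+ p ℚ./ suc p))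
fraction-above γ (ε , ε>0 , N , h) =
  let p , r<ε = archimedean ε ε>0
      r = ℤ.+ 1 ℚ./ suc p
      s = ℤ.+ p ℚ./ suc p
  in p , ε ℚ.- r , subst (ℚ._< ε ℚ.- r) (ℚ.+-inverseʳ r) (ℚ.+-monoˡ-< (ℚ.- r) r<ε) , N , λ n n≥ →
     ≤-from-difference (0≤q-p (subst (seq γ n ℚ.+ ε ℚ.≤_) (sym (p/q+1/q≡1 p)) (h n n≥)))
       (ℚR.solve 4 (λ g ε r s → (s ℚR.:+ r) ℚR.:- (g ℚR.:+ ε) ℚR.:= s ℚR.:- (g ℚR.:+ (ε ℚR.:- r))) refl (seq γ n) ε r s)

-- With 1/q < γ, Y < c would give Q ≤ Y^q ≤ c^q. Taken at c = c₆, it makes the sides of the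
-- rectangle at most 1.
power-eventually-large : ∀ γ → 0ℝ < γ → ∀ c → 0ℝ ⊑ c →
  ∃[ q ] (∀ Q Y → IsPower Q γ Y → c ^ q ⊏ Q → c ⊑ Y)
power-eventually-large γ γ>0 c 0⊑c =
  let p , 1/q<γ = reciprocal-below γ γ>0
      q = suc p
  in q , λ Q Y pow c^q<Q → ⊑-from-¬ λ Y<c → ⊏⇒⋣ c^q<Q (begin
    Q      ≈⟨ ≃-trans (*-comm Q 1ℝ) (*-identityˡ Q) ⟨
    Q ^ 1  ≤⟨ ≤⇒⊑ (IsPower.lower pow 1 q 1/q<γ) ⟩
    Y ^ q  ≤⟨ ^-mono-⊑ q (⊏⇒⊑ (<⇒⊏ (IsPower.positive pow))) (⊏⇒⊑ Y<c) ⟩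
    c ^ q  ∎)
  where open ⊑-Reasoning

-- With γ < p/q and q = p + 1, Q < M Y would give Q^q ≤ M^q Y^q ≤ M^q Q^p, contradicting M^q < Q
-- multiplied by Q^p. It makes the sides long compared with 1/Q.
power-eventually-small : ∀ γ → γ < 1ℝ → ∀ M → 0ℝ ⊑ M →
  ∃[ q ] (∀ Q Y → 0ℝ ⊏ Q → IsPower Q γ Y → M ^ q ⊏ Q → M * Y ⊑ Q)
power-eventually-small γ γ<1 M 0⊑M =
  let p , γ<p/q = fraction-above γ γ<1
      q = suc p
  in q , λ Q Y Q>0 pow M^q<Q → ⊑-from-¬ λ Q<MY → ⊏⇒⋣ (*-monoˡ-⊏ (0⊏^ p Q>0) M^q<Q) (begin
    Q ^ p * Q       ≈⟨ *-comm (Q ^ p) Q ⟩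
    Q ^ q           ≤⟨ ^-mono-⊑ q (⊏⇒⊑ Q>0) (⊏⇒⊑ Q<MY) ⟩
    (M * Y) ^ q     ≈⟨ *-^-distrib M Y q ⟩
    M ^ q * Y ^ q   ≤⟨ *-monoˡ-⊑ (0⊑^ q 0⊑M) (≤⇒⊑ (IsPower.upper pow p q γ<p/q)) ⟩
    M ^ q * Q ^ p   ≈⟨ *-comm (M ^ q) (Q ^ p) ⟩
    Q ^ p * M ^ q   ∎)
  where open ⊑-Reasoning

-- From points of the rectangle to the constant `c₇`

∈ᵢ⇒near-midpoint : ∀ I x {d w} → x ∈ᵢ I → midpoint I ≈ d → length₁ I ≃ w → ∣ x - d ∣ ⊑ fromℚ ½ * w
∈ᵢ⇒near-midpoint I x {d} {w} (lo≤x , x≤hi) mid len = ∣x∣⊑-from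
  (begin
    x - d           ≤⟨ +-mono-⊑ (≤⇒⊑ x≤hi) (≃⇒⊑ (-‿cong (≃-sym (≈⇒≃ mid)))) ⟩
    b - midpoint I  ≈⟨ ≃-pointwise (λ n → half-above (seq a n) (seq b n)) ⟩
    fromℚ ½ * (b - a) ≈⟨ *-cong ≃-refl len ⟩
    fromℚ ½ * w     ∎)
  (begin
    - (x - d)       ≈⟨ ≃-pointwise (λ n → ℚR.solve 2 (λ x d → ℚR.:- (x ℚR.:- d) ℚR.:= d ℚR.:- x) refl (seq x n) (seq d n)) ⟩
    d - x           ≤⟨ +-mono-⊑ (≃⇒⊑ (≃-sym (≈⇒≃ mid))) (neg-antimono (≤⇒⊑ lo≤x)) ⟩
    midpoint I - a  ≈⟨ ≃-pointwise (λ n → half-below (seq a n) (seq b n)) ⟩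
    fromℚ ½ * (b - a) ≈⟨ *-cong ≃-refl len ⟩
    fromℚ ½ * w     ∎)
  where
  open ⊑-Reasoning
  a = lo I
  b = hi I
  half-above : ∀ a b → b ℚ.- ½ ℚ.* (a ℚ.+ b) ≡ ½ ℚ.* (b ℚ.- a)
  half-above a b = trans (cong (ℚ._- ½ ℚ.* (a ℚ.+ b)) (sym (halves b)))
    (ℚR.solve 3 (λ h a b → h ℚR.:* b ℚR.:+ h ℚR.:* b ℚR.:- h ℚR.:* (a ℚR.:+ b) ℚR.:= h ℚR.:* (b ℚR.:- a)) refl ½ a b)
  half-below : ∀ a b → ½ ℚ.* (a ℚ.+ b) ℚ.- a ≡ ½ ℚ.* (b ℚ.- a)
  half-below a b = trans (cong (λ c → ½ ℚ.* (a ℚ.+ b) ℚ.- c) (sym (halves a)))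
    (ℚR.solve 3 (λ h a b → h ℚR.:* (a ℚR.:+ b) ℚR.:- (h ℚR.:* a ℚR.:+ h ℚR.:* a) ℚR.:= h ℚR.:* (b ℚR.:- a)) refl ½ a b)
  neg-antimono : ∀ {x y} → x ⊑ y → - y ⊑ - x
  neg-antimono {x} {y} p = ⊑-from-difference (⊑-trans (0⊑y-x p) (≃⇒⊑ (≃-pointwise λ n →
    ℚR.solve 2 (λ x y → y ℚR.:- x ℚR.:= ℚR.:- x ℚR.:- ℚR.:- y) refl (seq x n) (seq y n))))

[8Q]^m≃ : ∀ Q m → (fromℕ 8 * Q) ^ m ≃ fromℕ (8 ℕ.^ m) * Q ^ m
[8Q]^m≃ Q m = ≃-trans (*-^-distrib (fromℕ 8) Q m) (*-cong (fromℕ-^ 8 m) ≃-refl)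
  where
  fromℕ-^ : ∀ k m → fromℕ k ^ m ≃ fromℕ (k ℕ.^ m)
  fromℕ-^ k zero    = ≃-refl
  fromℕ-^ k (suc m) = ≃-trans (*-cong ≃-refl (fromℕ-^ k m)) (≃-sym (fromℕ-homo-* k (k ℕ.^ m)))

-- For n = m + 2 the exponent is 14 + 3m, and 16384 = 2¹⁴. This isolates the factor 8^m that the
-- count also contains.
2^[3n+8]≡ : ∀ m → 2 ℕ.^ (3 ℕ.* (2 ℕ.+ m) ℕ.+ 8) ≡ 16384 ℕ.* 8 ℕ.^ m
2^[3n+8]≡ m = trans (cong (2 ℕ.^_) exponent) (trans (ℕ.^-distribˡ-+-* 2 14 (3 ℕ.* m))
  (cong (16384 ℕ.*_) (sym (ℕ.^-*-assoc 2 3 m))))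
  where
  exponent : 3 ℕ.* (2 ℕ.+ m) ℕ.+ 8 ≡ 14 ℕ.+ 3 ℕ.* m
  exponent = trans (cong (ℕ._+ 8) (ℕ.*-distribˡ-+ 3 2 m)) (ℕ.+-comm (6 ℕ.+ 3 ℕ.* m) 8)

15⊏16384 : fromℕ 15 ⊏ fromℕ 16384
15⊏16384 = begin-strict
  fromℕ 15      <⟨ <⇒⊏ (x<x+ε (fromℕ 15) (ℚ.positive⁻¹ 1ℚ)) ⟩
  fromℕ 15 + 1ℝ ≈⟨ fromℕ-homo-+ 15 1 ⟨
  fromℕ 16      ≤⟨ fromℕ-mono (ℕ.m≤m+n 16 16368) ⟩
  fromℕ 16384   ∎
  where open ⊑-Reasoning

module Rectangle (m : ℕ) (Q d₁ d₂ w₁ w₂ : ℝ) (1⊏Q : 1ℝ ⊏ Q) (d₁≠d₂ : d₁ # d₂)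
  (0⊏w₁ : 0ℝ ⊏ w₁) (0⊏w₂ : 0ℝ ⊏ w₂) (w₁⊑1 : w₁ ⊑ 1ℝ) (w₂⊑1 : w₂ ⊑ 1ℝ)
  (wide₁ : 1ℝ + ∣ d₁ - d₂ ∣ ⊑ w₁ * Q) (wide₂ : 1ℝ + ∣ d₁ - d₂ ∣ ⊑ w₂ * Q) where
  open ⊑-Reasoning

  n : ℕ
  n = 2 ℕ.+ m

  Δ u S₁ S₂ X : ℝ
  Δ  = ∣ d₁ - d₂ ∣
  u  = recip Δ (#⇒0<∣-∣ d₁ d₂ d₁≠d₂)
  S₁ = geometric n (∣ d₁ ∣ + 1ℝ)
  S₂ = geometric n (∣ d₂ ∣ + 1ℝ)

  half⊑1 : ∀ {w} → 0ℝ ⊏ w → w ⊑ 1ℝ → fromℚ ½ * w ⊑ 1ℝ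
  half⊑1 {w} 0⊏w w⊑1 = begin
    fromℚ ½ * w               ≤⟨ x⊑x+y (fromℚ ½ * w) (0⊑* (⊑-pointwise λ _ → ℚ.nonNegative⁻¹ ½) (⊏⇒⊑ 0⊏w)) ⟩
    fromℚ ½ * w + fromℚ ½ * w ≈⟨ ≃-pointwise (λ k → halves (seq w k)) ⟩
    w                         ≤⟨ w⊑1 ⟩
    1ℝ                        ∎

  open Counting n Q d₁ d₂ (fromℚ ½ * w₁) (fromℚ ½ * w₂) (half⊑1 0⊏w₁ w₁⊑1) (half⊑1 0⊏w₂ w₂⊑1)
  open Point

  -- The factor common to both sides: the count is at most 15 `X`, and the claimed bound is 16384
  -- `X`.
  X = fromℕ (8 ℕ.^ m) * N * (S₁ * S₂ * u) * Q ^ n * (w₁ * w₂)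

  0⊏Q : 0ℝ ⊏ Q
  0⊏Q = ⊏-trans 0⊏1 1⊏Q

  1⊑S : ∀ d → 1ℝ ⊑ geometric n (∣ d ∣ + 1ℝ)
  1⊑S d = 1⊑geometric n (0⊑+ (0⊑∣x∣ d) 0⊑1)

  0⊏u : 0ℝ ⊏ u
  0⊏u = 0⊏recip Δ (#⇒0<∣-∣ d₁ d₂ d₁≠d₂)

  0⊏X : 0ℝ ⊏ X
  0⊏X = 0⊏* (0⊏* (0⊏* (0⊏* (positive (fromℕ-mono {1} {8 ℕ.^ m} (ℕ.m^n>0 8 m))) 0⊏N)
          (0⊏* (0⊏* (positive (1⊑S d₁)) (positive (1⊑S d₂))) 0⊏u)) (0⊏^ n 0⊏Q)) (0⊏* 0⊏w₁ 0⊏w₂)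
    where
    positive : ∀ {x} → 1ℝ ⊑ x → 0ℝ ⊏ x
    positive = ⊏-⊑-trans 0⊏1
    0⊏n : 0ℝ ⊏ fromℕ n
    0⊏n = positive (fromℕ-mono {1} {n} (ℕ.s≤s ℕ.z≤n))
    0⊏N : 0ℝ ⊏ N
    0⊏N = 0⊏* 0⊏n (0⊏* 0⊏n 0⊏1)

  L≃ : ∀ w S → fromℚ ½ * w * (Q * S) + fromℚ ½ * w * (Q * S) ≃ w * Q * S
  L≃ w S = ≃-pointwise λ k → trans
    (ℚR.solve 4 (λ h w q s → h ℚR.:* w ℚR.:* (q ℚR.:* s) ℚR.:+ h ℚR.:* w ℚR.:* (q ℚR.:* s) ℚR.:=
      (h ℚR.:* w ℚR.:+ h ℚR.:* w) ℚR.:* q ℚR.:* s) refl ½ (seq w k) (seq Q k) (seq S k))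
    (cong (λ v → v ℚ.* seq Q k ℚ.* seq S k) (halves (seq w k)))

  -- Asking for 1 + Δ at once yields both 1 ≤ L, for rounding the constant coefficient, and Δ ≤ L,
  -- for rounding the linear one. Since ρₙ(d) ≥ 1, it is enough that w Q be this large.
  1+Δ⊑L : ∀ {w} d → 1ℝ + Δ ⊑ w * Q →
          1ℝ + Δ ⊑ fromℚ ½ * w * (Q * geometric n (∣ d ∣ + 1ℝ)) + fromℚ ½ * w * (Q * geometric n (∣ d ∣ + 1ℝ))
  1+Δ⊑L {w} d wide = begin
    1ℝ + Δ      ≤⟨ wide ⟩
    w * Q       ≈⟨ ≃-trans (*-comm (w * Q) 1ℝ) (*-identityˡ (w * Q)) ⟨
    w * Q * 1ℝ  ≤⟨ *-monoˡ-⊑ (⊑-trans (0⊑+ 0⊑1 (0⊑∣x∣ (d₁ - d₂))) wide) (1⊑S d) ⟩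
    w * Q * S   ≈⟨ L≃ w S ⟨
    fromℚ ½ * w * (Q * S) + fromℚ ½ * w * (Q * S) ∎
    where S = geometric n (∣ d ∣ + 1ℝ)

  1⊑L₁ : 1ℝ ⊑ L₁
  1⊑L₁ = ⊑-trans (x⊑x+y 1ℝ (0⊑∣x∣ (d₁ - d₂))) (1+Δ⊑L d₁ wide₁)
  1⊑L₂ : 1ℝ ⊑ L₂
  1⊑L₂ = ⊑-trans (x⊑x+y 1ℝ (0⊑∣x∣ (d₁ - d₂))) (1+Δ⊑L d₂ wide₂)
  Δ⊑L₁ : Δ ⊑ L₁
  Δ⊑L₁ = ⊑-trans (x⊑y+x Δ 0⊑1) (1+Δ⊑L d₁ wide₁)
  Δ⊑L₂ : Δ ⊑ L₂
  Δ⊑L₂ = ⊑-trans (x⊑y+x Δ 0⊑1) (1+Δ⊑L d₂ wide₂)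

  Bounded-Distinct : Bounded Distinct (fromℕ 15 * X)
  Bounded-Distinct = Bounded-mono (≃⇒⊑ total) (Bounded-map Distinct⇒AgreeFrom (AgreeFrom-2+m-bound (⊏⇒⊑ 1⊏Q)
    (AgreeFrom-2-area-bound u (⊏⇒⊑ 0⊏u) (recip-inverseʳ Δ (#⇒0<∣-∣ d₁ d₂ d₁≠d₂))
      (⊑-trans 0⊑1 1⊑L₁) (⊑-trans 0⊑1 1⊑L₂) 1⊑L₁ 1⊑L₂ Δ⊑L₁ Δ⊑L₂) m))
    where
    total : (fromℕ 8 * Q) ^ m * (fromℕ 15 * (L₁ * L₂ * u) * N) ≃ fromℕ 15 * X
    total = begin-equality
      (fromℕ 8 * Q) ^ m * (fromℕ 15 * (L₁ * L₂ * u) * N)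
        ≈⟨ *-cong ([8Q]^m≃ Q m) (*-cong (*-cong ≃-refl (*-cong (*-cong (L≃ w₁ S₁) (L≃ w₂ S₂)) ≃-refl)) ≃-refl) ⟩
      (fromℕ (8 ℕ.^ m) * Q ^ m) * (fromℕ 15 * (w₁ * Q * S₁ * (w₂ * Q * S₂) * u) * N)
        ≈⟨ ≃-pointwise (λ k → ℚR.solve 10 (λ e Qm c w₁ Q S₁ w₂ S₂ u N →
             (e ℚR.:* Qm) ℚR.:* (c ℚR.:* (w₁ ℚR.:* Q ℚR.:* S₁ ℚR.:* (w₂ ℚR.:* Q ℚR.:* S₂) ℚR.:* u) ℚR.:* N) ℚR.:=
             c ℚR.:* (e ℚR.:* N ℚR.:* (S₁ ℚR.:* S₂ ℚR.:* u) ℚR.:* (Q ℚR.:* (Q ℚR.:* Qm)) ℚR.:* (w₁ ℚR.:* w₂))) refl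
             (ℤ.+ (8 ℕ.^ m) ℚ./ 1) (seq (Q ^ m) k) (ℤ.+ 15 ℚ./ 1) (seq w₁ k) (seq Q k) (seq S₁ k)
             (seq w₂ k) (seq S₂ k) (seq u k) (seq N k)) ⟩
      fromℕ 15 * X ∎

  module _ (I₁ I₂ : Interval) (mid₁ : midpoint I₁ ≈ d₁) (mid₂ : midpoint I₂ ≈ d₂)
    (len₁ : length₁ I₁ ≃ w₁) (len₂ : length₁ I₂ ≃ w₂) where

    toPoint : ∀ {α} → (Ã² n Q ∩ rectangle I₁ I₂) α → Point
    toPoint {α} ((P , minimal , height≤Q) , x∈I₁ , y∈I₂) = record
      { α₁      = proj₁ α
      ; α₂      = proj₂ α
      ; poly    = P
      ; leading = proj₁ (IsMinimalPolynomial.monic minimal)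
      ; degree  = proj₂ (IsMinimalPolynomial.monic minimal)
      ; small   = λ i → ⊑-trans (fromℕ-mono (∣coeffℤ∣≤height P i)) (≤⇒⊑ height≤Q)
      ; root₁   = ≈⇒≃ (IsMinimalPolynomial.root₁ minimal)
      ; root₂   = ≈⇒≃ (IsMinimalPolynomial.root₂ minimal)
      ; near₁   = ∈ᵢ⇒near-midpoint I₁ (proj₁ α) x∈I₁ mid₁ len₁
      ; near₂   = ∈ᵢ⇒near-midpoint I₂ (proj₂ α) y∈I₂ mid₂ len₂
      }

    length-reduce : ∀ {xs} (ss : All (Ã² n Q ∩ rectangle I₁ I₂) xs) → length (All.reduce toPoint ss) ≡ length xs
    length-reduce []       = refl
    length-reduce (s ∷ ss) = cong suc (length-reduce ss)

    Distinct-reduce : ∀ {xs} → Unique xs → (ss : All (Ã² n Q ∩ rectangle I₁ I₂) xs) →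
                      AllPairs Distinct (All.reduce toPoint ss)
    Distinct-reduce []       []       = []
    Distinct-reduce (r ∷ rs) (s ∷ ss) = from-head r ss ∷ Distinct-reduce rs ss
      where
      from-head : ∀ {ys} → All _ ys → (ts : All (Ã² n Q ∩ rectangle I₁ I₂) ys) →
                  All (Distinct (toPoint s)) (All.reduce toPoint ts)
      from-head []       []       = []
      from-head (q ∷ qs) (t ∷ ts) = (λ (≃₁ , ≃₂) → q (≃⇒≈ ≃₁ , ≃⇒≈ ≃₂)) ∷ from-head qs ts

    length⊑15X : ∀ xs → Unique xs → All (Ã² n Q ∩ rectangle I₁ I₂) xs → fromℕ (length xs) ⊑ fromℕ 15 * X
    length⊑15X xs unique all = subst (λ k → fromℕ k ⊑ fromℕ 15 * X) (length-reduce all)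
      (Bounded-Distinct (All.reduce toPoint all) (Distinct-reduce unique all))

    right-side : ∀ {ρ₁ ρ₂} → ρ₁ ≃ S₁ → ρ₂ ≃ S₂ →
                 c₇ n ρ₁ ρ₂ d₁ d₂ d₁≠d₂ * Q ^ n * area I₁ I₂ ≃ fromℕ 16384 * X
    right-side {ρ₁} {ρ₂} ρ₁≃S₁ ρ₂≃S₂ = begin-equality
      fromℕ (2 ℕ.^ (3 ℕ.* n ℕ.+ 8) ℕ.* n ℕ.^ 2) * ρ₁ * ρ₂ * u * Q ^ n * (length₁ I₁ * length₁ I₂)
        ≈⟨ *-cong (*-cong (*-cong (*-cong (*-cong constant ρ₁≃S₁) ρ₂≃S₂) ≃-refl) ≃-refl) (*-cong len₁ len₂) ⟩
      (fromℕ 16384 * e * N) * S₁ * S₂ * u * Q ^ n * (w₁ * w₂)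
        ≈⟨ ≃-pointwise (λ k → ℚR.solve 8 (λ c e N S₁ S₂ u q w →
             (c ℚR.:* e ℚR.:* N) ℚR.:* S₁ ℚR.:* S₂ ℚR.:* u ℚR.:* q ℚR.:* w ℚR.:=
             c ℚR.:* (e ℚR.:* N ℚR.:* (S₁ ℚR.:* S₂ ℚR.:* u) ℚR.:* q ℚR.:* w)) refl
             (ℤ.+ 16384 ℚ./ 1) (ℤ.+ (8 ℕ.^ m) ℚ./ 1) (seq N k) (seq S₁ k) (seq S₂ k) (seq u k)
             (seq (Q ^ n) k) (seq (w₁ * w₂) k)) ⟩
      fromℕ 16384 * X ∎
      where
      e = fromℕ (8 ℕ.^ m)
      constant : fromℕ (2 ℕ.^ (3 ℕ.* n ℕ.+ 8) ℕ.* n ℕ.^ 2) ≃ fromℕ 16384 * e * N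
      constant = begin-equality
        fromℕ (2 ℕ.^ (3 ℕ.* n ℕ.+ 8) ℕ.* n ℕ.^ 2)
          ≈⟨ fromℕ-homo-* (2 ℕ.^ (3 ℕ.* n ℕ.+ 8)) (n ℕ.^ 2) ⟩
        fromℕ (2 ℕ.^ (3 ℕ.* n ℕ.+ 8)) * fromℕ (n ℕ.^ 2)
          ≈⟨ *-cong (≃-pointwise λ _ → cong (λ k → ℤ.+ k ℚ./ 1) (2^[3n+8]≡ m)) ≃-refl ⟩
        fromℕ (16384 ℕ.* 8 ℕ.^ m) * fromℕ (n ℕ.^ 2)
          ≈⟨ *-cong (fromℕ-homo-* 16384 (8 ℕ.^ m))
               (≃-trans (fromℕ-homo-* n (n ℕ.* 1)) (*-cong ≃-refl (fromℕ-homo-* n 1))) ⟩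
        fromℕ 16384 * e * N ∎

    #-bound : ∀ {ρ₁ ρ₂} → ρ₁ ≃ S₁ → ρ₂ ≃ S₂ →
              # (Ã² n Q ∩ rectangle I₁ I₂) < c₇ n ρ₁ ρ₂ d₁ d₂ d₁≠d₂ * Q ^ n * area I₁ I₂
    #-bound {ρ₁} {ρ₂} ρ₁≃S₁ ρ₂≃S₂ xs unique all = ⊏⇒< (begin-strict
      fromℕ (length xs)   ≤⟨ length⊑15X xs unique all ⟩
      fromℕ 15 * X        ≈⟨ *-comm (fromℕ 15) X ⟩
      X * fromℕ 15        <⟨ *-monoˡ-⊏ 0⊏X 15⊏16384 ⟩
      X * fromℕ 16384     ≈⟨ *-comm X (fromℕ 16384) ⟩
      fromℕ 16384 * X     ≈⟨ right-side ρ₁≃S₁ ρ₂≃S₂ ⟨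
      c₇ n ρ₁ ρ₂ d₁ d₂ d₁≠d₂ * Q ^ n * area I₁ I₂ ∎)

-- The choice of `Q₀`

side⊑1 : ∀ {c y} (y>0 : 0ℝ < y) → c ⊑ y → c * recip y y>0 ⊑ 1ℝ
side⊑1 {c} {y} y>0 c⊑y = ⊑-trans (*-monoʳ-⊑ (⊏⇒⊑ (0⊏recip y y>0)) c⊑y) (≃⇒⊑ (recip-inverseʳ y y>0))

-- Writes a as (c / y) · (a y / c) and bounds the second factor by Q; used with a = 1 + |d₁ - d₂|
-- and c = c₆.
side-wide : ∀ {a c y Q} (c>0 : 0ℝ < c) (y>0 : 0ℝ < y) → a * recip c c>0 * y ⊑ Q → a ⊑ c * recip y y>0 * Q
side-wide {a} {c} {y} {Q} c>0 y>0 h = begin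
  a                        ≈⟨ *-identityˡ a ⟨
  1ℝ * a                   ≈⟨ *-cong (*-identityˡ 1ℝ) ≃-refl ⟨
  1ℝ * 1ℝ * a              ≈⟨ *-cong (*-cong (recip-inverseʳ c c>0) (recip-inverseʳ y y>0)) ≃-refl ⟨
  c * c⁻¹ * (y * y⁻¹) * a  ≈⟨ ≃-pointwise (λ k → ℚR.solve 5 (λ a c c⁻¹ y y⁻¹ →
                                c ℚR.:* c⁻¹ ℚR.:* (y ℚR.:* y⁻¹) ℚR.:* a ℚR.:= c ℚR.:* y⁻¹ ℚR.:* (a ℚR.:* c⁻¹ ℚR.:* y)) refl
                                (seq a k) (seq c k) (seq c⁻¹ k) (seq y k) (seq y⁻¹ k)) ⟩
  c * y⁻¹ * (a * c⁻¹ * y)  ≤⟨ *-monoˡ-⊑ (0⊑* (⊏⇒⊑ (<⇒⊏ c>0)) (⊏⇒⊑ (0⊏recip y y>0))) h ⟩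
  c * y⁻¹ * Q              ∎
  where
  open ⊑-Reasoning
  c⁻¹ = recip c c>0
  y⁻¹ = recip y y>0

theorem2 : ∀ (n : ℕ) → 2 ℕ.≤ n →
    ∀ (γ₁ γ₂ : ℝ) → 0ℝ < γ₁ → γ₁ < 1ℝ → 0ℝ < γ₂ → γ₂ < 1ℝ →
    ∀ (c₆ : ℝ) → 0ℝ < c₆ →
    ∀ (d₁ d₂ : ℝ) (d₁≠d₂ : d₁ # d₂) →
    ∃[ Q₀ ] (∀ (Q : ℝ) → 1ℝ < Q → Q₀ < Q →
    ∀ (Q^γ₁ Q^γ₂ : ℝ) (pow₁ : IsPower Q γ₁ Q^γ₁) (pow₂ : IsPower Q γ₂ Q^γ₂) →
    ∀ (I₁ I₂ : Interval) →
    midpoint I₁ ≈ d₁ → length₁ I₁ ≈ c₆ * recip Q^γ₁ (IsPower.positive pow₁) →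
    midpoint I₂ ≈ d₂ → length₁ I₂ ≈ c₆ * recip Q^γ₂ (IsPower.positive pow₂) →
    ∀ (ρ₁ ρ₂ : ℝ) → IsRho n d₁ ρ₁ → IsRho n d₂ ρ₂ →
    # (Ã² n Q ∩ rectangle I₁ I₂) < c₇ n ρ₁ ρ₂ d₁ d₂ d₁≠d₂ * Q ^ n * area I₁ I₂)
theorem2 (suc (suc m)) (ℕ.s≤s (ℕ.s≤s ℕ.z≤n)) γ₁ γ₂ γ₁>0 γ₁<1 γ₂>0 γ₂<1 c₆ c₆>0 d₁ d₂ d₁≠d₂ =
  let 0⊑c₆ = ⊏⇒⊑ (<⇒⊏ c₆>0)
      -- With this `M`, M Y ≤ Q says that (c₆ / Y) Q ≥ 1 + |d₁ - d₂|, the width that the rounding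
      -- requires.
      M    = (1ℝ + ∣ d₁ - d₂ ∣) * recip c₆ c₆>0
      0⊑M  = 0⊑* (0⊑+ 0⊑1 (0⊑∣x∣ (d₁ - d₂))) (⊏⇒⊑ (0⊏recip c₆ c₆>0))
      p₁ , large₁ = power-eventually-large γ₁ γ₁>0 c₆ 0⊑c₆
      p₂ , large₂ = power-eventually-large γ₂ γ₂>0 c₆ 0⊑c₆
      q₁ , small₁ = power-eventually-small γ₁ γ₁<1 M 0⊑M
      q₂ , small₂ = power-eventually-small γ₂ γ₂<1 M 0⊑M
      0⊑a = 0⊑^ p₁ 0⊑c₆
      0⊑b = 0⊑^ p₂ 0⊑c₆
      0⊑c = 0⊑^ q₁ 0⊑M
      0⊑d = 0⊑^ q₂ 0⊑M
      ab  = c₆ ^ p₁ + c₆ ^ p₂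
      cd  = M ^ q₁ + M ^ q₂
      0⊑ab = 0⊑+ 0⊑a 0⊑b
      0⊑cd = 0⊑+ 0⊑c 0⊑d
  -- The four powers are nonnegative, so their sum exceeds none of its uses as a maximum: Q above it
  -- lies above each of them.
  in ab + cd , λ Q 1<Q Q₀<Q Y₁ Y₂ pow₁ pow₂ I₁ I₂ mid₁ len₁ mid₂ len₂ ρ₁ ρ₂ rho₁ rho₂ →
    let 0⊏Q = ⊏-trans 0⊏1 (<⇒⊏ 1<Q)
        ab⊏Q = ⊑-⊏-trans (x⊑x+y ab 0⊑cd) (<⇒⊏ Q₀<Q)
        cd⊏Q = ⊑-⊏-trans (x⊑y+x cd 0⊑ab) (<⇒⊏ Q₀<Q)
        Y₁>0 = IsPower.positive pow₁
        Y₂>0 = IsPower.positive pow₂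
    in Rectangle.#-bound m Q d₁ d₂ (c₆ * recip Y₁ Y₁>0) (c₆ * recip Y₂ Y₂>0) (<⇒⊏ 1<Q) d₁≠d₂
         (0⊏* (<⇒⊏ c₆>0) (0⊏recip Y₁ Y₁>0)) (0⊏* (<⇒⊏ c₆>0) (0⊏recip Y₂ Y₂>0))
         (side⊑1 Y₁>0 (large₁ Q Y₁ pow₁ (⊑-⊏-trans (x⊑x+y _ 0⊑b) ab⊏Q)))
         (side⊑1 Y₂>0 (large₂ Q Y₂ pow₂ (⊑-⊏-trans (x⊑y+x _ 0⊑a) ab⊏Q)))
         (side-wide c₆>0 Y₁>0 (small₁ Q Y₁ 0⊏Q pow₁ (⊑-⊏-trans (x⊑x+y _ 0⊑d) cd⊏Q)))
         (side-wide c₆>0 Y₂>0 (small₂ Q Y₂ 0⊏Q pow₂ (⊑-⊏-trans (x⊑y+x _ 0⊑c) cd⊏Q)))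
         I₁ I₂ mid₁ mid₂ (≈⇒≃ len₁) (≈⇒≃ len₂) (IsRho⇒geometric rho₁) (IsRho⇒geometric rho₂)
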